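{- For every integer $d\ge0$, the image of $\Psi_d\colon\mathrm{Mat}_d\to\mathrm{WQSym}_d$ has dimension at least $2^d-d$. Specifically, there is a collection of $2^d-d$ Schubert matroids on $[d]$ whose chromatic word-quasisymmetric functions $\Psi(M)$ are linearly independent.
   Context: $[d]=\{1,\dots,d\}$, $[0]=\emptyset$. For a matroid $M$ on $[d]$, $f\colon[d]\to\mathbb R$ and a basis $B$ put $f(B)=\sum_{i\in B}f(i)$; $f$ is $M$-generic if there is a unique basis $B$ of $M$ maximizing $f(B)$. Let $w_1,w_2,\dots$ be non-commuting variables and $w_f=w_{f(1)}w_{f(2)}\cdots w_{f(d)}$ for $f\colon[d]\to\mathbb Z_{\ge1}$. The chromatic word-quasisymmetric function of $M$ is $\Psi(M)=\sum_{f} w_f$, the sum over all $M$-generic $f\colon[d]\to\mathbb Z_{\ge 1}$. The set composition type of $f$ is the ordered partition of $[d]$ into the level sets of $f$, listed by increasing value. $\mathrm{WQSym}_d$ is the real vector space of formal series $\sum_{f:[d]\to\mathbb Z_{\ge1}}c_fw_f$ with $c_f=c_g$ whenever $f,g$ have the same set composition type. $\mathrm{Mat}_d$ is the real vector space with basis all matroids with ground set $[d]$, and $\Psi_d$ is the linear extension of $M\mapsto\Psi(M)$. For $A=\{a_1<\dots<a_r\}\subseteq[d]$, the Schubert matroid $\mathrm{SM}(A)$ is the matroid on $[d]$ whose bases are the sets $B=\{b_1<\dots<b_r\}\subseteq[d]$ with $b_i\le a_i$ for all $i=1,\dots,r$. -}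

module Defs where

open import Algebra.Bundles using (CommutativeRing; Ring)
open import Algebra.Definitions.RawMonoid using (sum)
open import Algebra.Module.Bundles using (LeftModule)
open import Algebra.Module.Morphism.Structures using (module LeftModuleMorphisms)
open import Data.Bool.Base using (Bool; true; false; if_then_else_)
import Data.Bool.Properties as Bool
open import Data.Empty using (⊥)
open import Data.Fin.Base as Fin using (Fin; zero; suc; toℕ)
import Data.Fin.Properties as Fin
open import Data.Fin.Subset as Subset
  using (Subset; inside; outside; _∈_; _∉_; _⊆_; _∪_; _─_; _-_; ⁅_⁆; Nonempty)
import Data.Fin.Subset.Properties as Subset
open import Data.Fin.Subset.Properties using (_∈?_; nonempty?; anySubset?)
open import Data.List.Base as List using (List; []; _∷_; _++_; allFin; filter; upTo)
open import Data.List.Membership.Propositional using () renaming (_∈_ to _∈ˡ_)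
import Data.List.Membership.Propositional as Mem
import Data.List.Membership.Propositional.Properties as Mem
import Data.List.Properties as List
open import Data.List.Relation.Binary.Pointwise as Pointwise using (Pointwise; []; _∷_)
open import Data.List.Relation.Unary.All as All using (All; []; _∷_)
import Data.List.Relation.Unary.All.Properties as All
open import Data.List.Relation.Unary.AllPairs using (AllPairs; []; _∷_)
import Data.List.Relation.Unary.AllPairs.Properties as AllPairs
open import Data.List.Relation.Unary.Any using (Any; here; there)
open import Data.Nat.Base as ℕ using (ℕ; zero; suc; s≤s)
open import Data.Nat.Induction using (<-wellFounded; Acc; acc)
import Data.Nat.ListAction as ℕ using (sum)
import Data.Nat.Properties as ℕ
open import Data.List.Extrema ℕ.≤-totalOrder
  using (max; argmin; xs≤max; argmin-sel; f[argmin]≤f[xs])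
open import Data.Product using (∃; ∃!; _×_; _,_; proj₁; proj₂)
open import Data.Rational.Base as ℚ using (ℚ; 0ℚ; 1ℚ; ½)
import Data.Rational.Properties as ℚ
open import Data.Rational.Solver using (module +-*-Solver)
open import Data.Sum.Base using (_⊎_; inj₁; inj₂)
open import Data.Vec.Base using ([]; _∷_; here; there; tabulate)
open import Data.Vec.Functional using (Vector)
import Data.Vec.Properties as Vec
open import Function.Base using (_∘_; id)
open import Function.Bundles using (_⇔_; mk⇔; Equivalence)
open import Function.Properties.Equivalence
  using () renaming (refl to ⇔-refl; sym to ⇔-sym; trans to ⇔-trans)
open import Level as Level using (0ℓ)
open import Relation.Binary.Bundles using (Setoid)
open import Relation.Binary.Core using (Rel)
open import Relation.Binary.PropositionalEquality
  using (_≡_; _≢_; refl; sym; trans; cong; cong₂; subst; subst₂)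
open import Relation.Binary.Structures using (IsEquivalence)
open import Relation.Nullary using (Dec; yes; no; does; ¬_; contradiction)
open import Relation.Nullary.Decidable
  using (map′; _×-dec_; _→-dec_; ¬?; decidable-stable; dec-true; does-⇔)
open import Relation.Unary using (Pred; Decidable)

infix 4 _~_

-- x and y eventually stay within every ε of each other.  In particular
-- x ~ x says that x is a Cauchy sequence, and on Cauchy sequences _~_ says
-- that the difference tends to 0.
record _~_ (x y : ℕ → ℚ) : Set where
  constructor eventually
  field within : ∀ ε → 0ℚ ℚ.< ε →
                 ∃ λ N → ∀ m n → N ℕ.≤ m → N ℕ.≤ n → ℚ.∣ x m ℚ.- y n ∣ ℚ.< ε

open _~_ public

module RealLaws where

  open +-*-Solver

  ⊔≤ˡ : ∀ m {n o} → m ℕ.⊔ n ℕ.≤ o → m ℕ.≤ o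
  ⊔≤ˡ m {n} = ℕ.≤-trans (ℕ.m≤m⊔n m n)

  ⊔≤ʳ : ∀ m {n o} → m ℕ.⊔ n ℕ.≤ o → n ℕ.≤ o
  ⊔≤ʳ m {n} = ℕ.≤-trans (ℕ.m≤n⊔m m n)

  ½ε : ∀ {ε} → 0ℚ ℚ.< ε → 0ℚ ℚ.< ½ ℚ.* ε
  ½ε {ε} 0<ε = subst (ℚ._< ½ ℚ.* ε) (ℚ.*-zeroʳ ½) (ℚ.*-monoʳ-<-pos ½ 0<ε)

  ½ε+½ε : ∀ ε → ½ ℚ.* ε ℚ.+ ½ ℚ.* ε ≡ ε
  ½ε+½ε ε = trans (sym (ℚ.*-distribʳ-+ ε ½ ½)) (ℚ.*-identityˡ ε)

  ∣p-q∣≡∣q-p∣ : ∀ p q → ℚ.∣ p ℚ.- q ∣ ≡ ℚ.∣ q ℚ.- p ∣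
  ∣p-q∣≡∣q-p∣ p q = trans (sym (ℚ.∣-p∣≡∣p∣ (p ℚ.- q)))
    (cong ℚ.∣_∣ (solve 2 (λ p q → :- (p :- q) := q :- p) refl p q))

  split : ∀ {p q r ε} → p ≡ q ℚ.+ r → ℚ.∣ q ∣ ℚ.< ½ ℚ.* ε → ℚ.∣ r ∣ ℚ.< ½ ℚ.* ε →
          ℚ.∣ p ∣ ℚ.< ε
  split {p} {q} {r} {ε} refl q< r< = ℚ.≤-<-trans (ℚ.∣p+q∣≤∣p∣+∣q∣ q r)
    (subst (ℚ.∣ q ∣ ℚ.+ ℚ.∣ r ∣ ℚ.<_) (½ε+½ε ε) (ℚ.+-mono-< q< r<))

  ~-sym : ∀ {x y} → x ~ y → y ~ x
  within (~-sym {x} {y} x~y) ε 0<ε with within x~y ε 0<ε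
  ... | N , h = N , λ m n N≤m N≤n →
    subst (ℚ._< ε) (∣p-q∣≡∣q-p∣ (x n) (y m)) (h n m N≤n N≤m)

  ~-trans : ∀ {x y z} → x ~ y → y ~ z → x ~ z
  within (~-trans {x} {y} {z} x~y y~z) ε 0<ε with within x~y _ (½ε 0<ε) | within y~z _ (½ε 0<ε)
  ... | N , h | N′ , h′ = N ℕ.⊔ N′ , λ m n N≤m N≤n →
    let k = N ℕ.⊔ N′ ; N≤k = ℕ.m≤m⊔n N N′ ; N′≤k = ℕ.m≤n⊔m N N′ in
    split (solve 3 (λ a b c → a :- c := (a :- b) :+ (b :- c)) refl (x m) (y k) (z n))
      (h m k (⊔≤ˡ N N≤m) N≤k) (h′ k n N′≤k (⊔≤ʳ N N≤n))

  +-cong : ∀ {x x′ y y′} → x ~ x′ → y ~ y′ →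
           (λ n → x n ℚ.+ y n) ~ (λ n → x′ n ℚ.+ y′ n)
  within (+-cong {x} {x′} {y} {y′} x~x′ y~y′) ε 0<ε with within x~x′ _ (½ε 0<ε) | within y~y′ _ (½ε 0<ε)
  ... | N , h | N′ , h′ = N ℕ.⊔ N′ , λ m n N≤m N≤n →
    split (solve 4 (λ a b c d → (a :+ b) :- (c :+ d) := (a :- c) :+ (b :- d)) refl
             (x m) (y m) (x′ n) (y′ n))
      (h m n (⊔≤ˡ N N≤m) (⊔≤ˡ N N≤n))
      (h′ m n (⊔≤ʳ N N≤m) (⊔≤ʳ N N≤n))

  neg-cong : ∀ {x x′} → x ~ x′ → (λ n → ℚ.- x n) ~ (λ n → ℚ.- x′ n)
  within (neg-cong {x} {x′} x~x′) ε 0<ε with within x~x′ ε 0<ε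
  ... | N , h = N , λ m n N≤m N≤n → subst (ℚ._< ε)
    (trans (sym (ℚ.∣-p∣≡∣p∣ (x m ℚ.- x′ n)))
      (cong ℚ.∣_∣ (solve 2 (λ a b → :- (a :- b) := (:- a) :- (:- b)) refl (x m) (x′ n))))
    (h m n N≤m N≤n)

  bound : ∀ {x} → x ~ x → ∃ λ K → 0ℚ ℚ.< K × ∃ λ N → ∀ n → N ℕ.≤ n → ℚ.∣ x n ∣ ℚ.≤ K
  bound {x} x~x with within x~x 1ℚ (ℚ.positive⁻¹ 1ℚ)
  ... | N , h = 1ℚ ℚ.+ ℚ.∣ x N ∣
    , ℚ.<-≤-trans (ℚ.positive⁻¹ 1ℚ)
        (subst (ℚ._≤ 1ℚ ℚ.+ ℚ.∣ x N ∣) (ℚ.+-identityʳ 1ℚ) (ℚ.+-monoʳ-≤ 1ℚ (ℚ.0≤∣p∣ (x N))))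
    , N , λ n N≤n → ℚ.≤-trans
        (subst (λ p → ℚ.∣ p ∣ ℚ.≤ ℚ.∣ x n ℚ.- x N ∣ ℚ.+ ℚ.∣ x N ∣)
          (solve 2 (λ a b → (a :- b) :+ b := a) refl (x n) (x N))
          (ℚ.∣p+q∣≤∣p∣+∣q∣ (x n ℚ.- x N) (x N)))
        (ℚ.+-monoˡ-≤ ℚ.∣ x N ∣ (ℚ.<⇒≤ (h n N N≤n ℕ.≤-refl)))

  scale : ∀ {ε K} → 0ℚ ℚ.< ε → 0ℚ ℚ.< K → ∃ λ δ → 0ℚ ℚ.< δ ×
          (∀ p q → ℚ.∣ p ∣ ℚ.≤ K → ℚ.∣ q ∣ ℚ.< δ → ℚ.∣ p ℚ.* q ∣ ℚ.< ε)
  scale {ε} {K} 0<ε 0<K = ε ℚ.* 1/K , 0<δ , λ p q p≤K q<δ →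
      subst₂ ℚ._<_ (sym (ℚ.∣p*q∣≡∣p∣*∣q∣ p q)) Kδ≡ε
        (ℚ.≤-<-trans
          (ℚ.*-monoʳ-≤-nonNeg ℚ.∣ q ∣ {{ℚ.∣-∣-nonNeg q}} p≤K)
          (ℚ.*-monoʳ-<-pos K {{K⁺}} q<δ))
    where
    K⁺ = ℚ.positive 0<K
    K≢0 = ℚ.pos⇒nonZero K {{K⁺}}
    1/K = (ℚ.1/ K) {{K≢0}}
    0<δ : 0ℚ ℚ.< ε ℚ.* 1/K
    0<δ = ℚ.positive⁻¹ _ {{ℚ.pos*pos⇒pos ε {{ℚ.positive 0<ε}} 1/K {{ℚ.1/pos⇒pos K {{K⁺}}}}}}
    Kδ≡ε : K ℚ.* (ε ℚ.* 1/K) ≡ ε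
    Kδ≡ε = trans (solve 3 (λ k e i → k :* (e :* i) := e :* (k :* i)) refl K ε 1/K)
             (trans (cong (ε ℚ.*_) (ℚ.*-inverseʳ K {{K≢0}})) (ℚ.*-identityʳ ε))

  *-cong : ∀ {x x′ y y′} → x ~ x′ → y ~ y′ →
           (λ n → x n ℚ.* y n) ~ (λ n → x′ n ℚ.* y′ n)
  within (*-cong {x} {x′} {y} {y′} x~x′ y~y′) ε 0<ε =
    let K  , 0<K  , M  , x≤K   = bound (~-trans x~x′ (~-sym x~x′))
        K′ , 0<K′ , M′ , y′≤K′ = bound (~-trans (~-sym y~y′) y~y′)
        δ  , 0<δ  , s  = scale (½ε 0<ε) 0<K
        δ′ , 0<δ′ , s′ = scale (½ε 0<ε) 0<K′
        N  , h  = within y~y′ δ 0<δ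
        N′ , h′ = within x~x′ δ′ 0<δ′
    in
    (M ℕ.⊔ M′) ℕ.⊔ (N ℕ.⊔ N′) , λ m n k≤m k≤n →
    split (solve 4 (λ a b c d → a :* b :- c :* d := a :* (b :- d) :+ d :* (a :- c)) refl
             (x m) (y m) (x′ n) (y′ n))
      (s (x m) (y m ℚ.- y′ n) (x≤K m (⊔≤ˡ M (⊔≤ˡ _ k≤m)))
        (h m n (⊔≤ˡ N (⊔≤ʳ (M ℕ.⊔ M′) k≤m)) (⊔≤ˡ N (⊔≤ʳ (M ℕ.⊔ M′) k≤n))))
      (s′ (y′ n) (x m ℚ.- x′ n) (y′≤K′ n (⊔≤ʳ M (⊔≤ˡ _ k≤n)))
        (h′ m n (⊔≤ʳ N (⊔≤ʳ (M ℕ.⊔ M′) k≤m)) (⊔≤ʳ N (⊔≤ʳ (M ℕ.⊔ M′) k≤n))))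

  const-cauchy : ∀ q → (λ _ → q) ~ (λ _ → q)
  within (const-cauchy q) ε 0<ε = 0 , λ _ _ _ _ → subst (ℚ._< ε) (cong ℚ.∣_∣ (sym (ℚ.+-inverseʳ q))) 0<ε

  pointwise : ∀ {x y} → x ~ x → (∀ n → x n ≡ y n) → x ~ y
  within (pointwise {x} x~x x≗y) ε 0<ε with within x~x ε 0<ε
  ... | N , h = N , λ m n N≤m N≤n → subst (λ q → ℚ.∣ x m ℚ.- q ∣ ℚ.< ε) (x≗y n) (h m n N≤m N≤n)

record ℝ : Set where
  constructor mkℝ
  field
    approx : ℕ → ℚ
    cauchy : approx ~ approx

open ℝ public

infix 4 _≈ℝ_

record _≈ℝ_ (x y : ℝ) : Set where
  constructor mk≈
  field converge : approx x ~ approx y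

open _≈ℝ_ public

fromℚ : ℚ → ℝ
fromℚ q = mkℝ (λ _ → q) (RealLaws.const-cauchy q)

ℝ-commutativeRing : CommutativeRing 0ℓ 0ℓ
ℝ-commutativeRing = record
  { Carrier = ℝ
  ; _≈_     = _≈ℝ_
  ; _+_     = λ x y → mkℝ (λ n → approx x n ℚ.+ approx y n) (+-cong (cauchy x) (cauchy y))
  ; _*_     = λ x y → mkℝ (λ n → approx x n ℚ.* approx y n) (*-cong (cauchy x) (cauchy y))
  ; -_      = λ x → mkℝ (λ n → ℚ.- approx x n) (neg-cong (cauchy x))
  ; 0#      = fromℚ 0ℚ
  ; 1#      = fromℚ 1ℚ
  ; isCommutativeRing = record
    { isRing = record
      { +-isAbelianGroup = record
        { isGroup = record
          { isMonoid = record
            { isSemigroup = record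
              { isMagma = record
                { isEquivalence = ≈-isEquivalence
                ; ∙-cong = λ (mk≈ p) (mk≈ q) → mk≈ (+-cong p q)
                }
              ; assoc = λ x y z → ≗⇒≈ λ n → ℚ.+-assoc (approx x n) (approx y n) (approx z n)
              }
            ; identity = (λ x → ≗⇒≈ λ n → ℚ.+-identityˡ (approx x n))
                       , (λ x → ≗⇒≈ λ n → ℚ.+-identityʳ (approx x n))
            }
          ; inverse = (λ x → ≗⇒≈ λ n → ℚ.+-inverseˡ (approx x n))
                    , (λ x → ≗⇒≈ λ n → ℚ.+-inverseʳ (approx x n))
          ; ⁻¹-cong = λ (mk≈ p) → mk≈ (neg-cong p)
          }
        ; comm = λ x y → ≗⇒≈ λ n → ℚ.+-comm (approx x n) (approx y n)
        }
      ; *-cong = λ (mk≈ p) (mk≈ q) → mk≈ (*-cong p q)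
      ; *-assoc = λ x y z → ≗⇒≈ λ n → ℚ.*-assoc (approx x n) (approx y n) (approx z n)
      ; *-identity = (λ x → ≗⇒≈ λ n → ℚ.*-identityˡ (approx x n))
                   , (λ x → ≗⇒≈ λ n → ℚ.*-identityʳ (approx x n))
      ; distrib = (λ x y z → ≗⇒≈ λ n → ℚ.*-distribˡ-+ (approx x n) (approx y n) (approx z n))
                , (λ x y z → ≗⇒≈ λ n → ℚ.*-distribʳ-+ (approx x n) (approx y n) (approx z n))
      }
    ; *-comm = λ x y → ≗⇒≈ λ n → ℚ.*-comm (approx x n) (approx y n)
    }
  }
  where
  open RealLaws

  ≗⇒≈ : ∀ {x y : ℝ} → (∀ n → approx x n ≡ approx y n) → x ≈ℝ y
  ≗⇒≈ {x} eq = mk≈ (pointwise (cauchy x) eq)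

  ≈-isEquivalence : IsEquivalence _≈ℝ_
  ≈-isEquivalence = record
    { refl  = λ {x} → mk≈ (cauchy x)
    ; sym   = λ (mk≈ p) → mk≈ (~-sym p)
    ; trans = λ (mk≈ p) (mk≈ q) → mk≈ (~-trans p q)
    }

private variable d : ℕ

elements : Subset d → List (Fin d)
elements {d} B = filter (_∈? B) (allFin d)

record Matroid (d : ℕ) : Set₁ where
  field
    IsBasis  : Pred (Subset d) 0ℓ
    isBasis? : Decidable IsBasis
    nonempty : ∃ IsBasis
    exchange : ∀ {B B′ x} → IsBasis B → IsBasis B′ → x ∈ B → x ∉ B′ →
               ∃ λ y → y ∈ B′ × y ∉ B × IsBasis ((B - x) ∪ ⁅ y ⁆)

open Matroid public using (IsBasis)

weight : (Fin d → ℕ) → Subset d → ℕ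
weight f B = ℕ.sum (List.map f (elements B))

Maximizes : Matroid d → (Fin d → ℕ) → Subset d → Set
Maximizes M f B = IsBasis M B × (∀ B′ → IsBasis M B′ → weight f B′ ℕ.≤ weight f B)

Generic : Matroid d → (Fin d → ℕ) → Set
Generic M f = ∃! _≡_ (Maximizes M f)

allSubsets? : ∀ {P : Pred (Subset d) 0ℓ} → Decidable P → Dec (∀ B → P B)
allSubsets? P? = map′
  (λ ∄¬P B → decidable-stable (P? B) λ ¬P → ∄¬P (B , ¬P))
  (λ ∀P (B , ¬P) → ¬P (∀P B))
  (¬? (anySubset? (¬? ∘ P?)))

_≟ˢ_ : (A B : Subset d) → Dec (A ≡ B)
_≟ˢ_ = Vec.≡-dec Bool._≟_

maximizes? : (M : Matroid d) (f : Fin d → ℕ) → Decidable (Maximizes M f)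
maximizes? M f B = isBasis? B ×-dec
  allSubsets? λ B′ → isBasis? B′ →-dec (weight f B′ ℕ.≤? weight f B)
  where open Matroid M

generic? : (M : Matroid d) (f : Fin d → ℕ) → Dec (Generic M f)
generic? M f = anySubset? λ B → maximizes? M f B ×-dec
  map′ (λ h {B′} → h B′) (λ h B′ → h {B′})
    (allSubsets? λ B′ → maximizes? M f B′ →-dec (B ≟ˢ B′))

levelSet : (Fin d → ℕ) → ℕ → Subset d
levelSet f k = tabulate λ i → does (f i ℕ.≟ k)

setComposition : (Fin d → ℕ) → List (Subset d)
setComposition {d} f =
  filter nonempty? (List.map (levelSet f) (upTo (suc (max 0 (List.map f (allFin d))))))

module SubsetLemmas where

  filter-suc : ∀ b (B : Subset d) xs →
               filter (_∈? (b ∷ B)) (List.map suc xs) ≡ List.map suc (filter (_∈? B) xs)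
  filter-suc b B []       = refl
  filter-suc b B (x ∷ xs) with x ∈? B
  ... | yes _ = cong (suc x ∷_) (filter-suc b B xs)
  ... | no  _ = filter-suc b B xs

  filter-tail : ∀ b (B : Subset d) →
                filter (_∈? (b ∷ B)) (List.tabulate suc) ≡ List.map suc (elements B)
  filter-tail {d} b B = trans
    (cong (filter (_∈? (b ∷ B))) (sym (List.map-tabulate {n = d} id suc)))
    (filter-suc b B (allFin d))

  elements-in : ∀ (B : Subset d) → elements (inside ∷ B) ≡ zero ∷ List.map suc (elements B)
  elements-in B = cong (zero ∷_) (filter-tail inside B)

  elements-out : ∀ (B : Subset d) → elements (outside ∷ B) ≡ List.map suc (elements B)
  elements-out B = filter-tail outside B

  weight-∷ : ∀ (f : Fin (suc d) → ℕ) b B →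
             weight f (b ∷ B) ≡ (if b then f zero else 0) ℕ.+ weight (f ∘ suc) B
  weight-∷ f true  B = trans (cong (ℕ.sum ∘ List.map f) (elements-in B))
    (cong (λ xs → f zero ℕ.+ ℕ.sum xs) (sym (List.map-∘ (elements B))))
  weight-∷ f false B = trans (cong (ℕ.sum ∘ List.map f) (elements-out B))
    (cong ℕ.sum (sym (List.map-∘ (elements B))))

  remove-zero : ∀ b (B : Subset d) → (b ∷ B) - zero ≡ outside ∷ B
  remove-zero b B = cong (outside ∷_) (Subset.p─⊥≡p B)

  weight-remove : ∀ (f : Fin d → ℕ) {B x} → x ∈ B → weight f (B - x) ℕ.+ f x ≡ weight f B
  weight-remove f {true ∷ B} here
    rewrite remove-zero true B | weight-∷ f false B | weight-∷ f true B
    = ℕ.+-comm (weight (f ∘ suc) B) (f zero)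
  weight-remove f {b ∷ B} {suc x} (there x∈B) =
    trans (cong (ℕ._+ f (suc x)) (weight-∷ f b (B - x)))
      (trans (ℕ.+-assoc (if b then f zero else 0) (weight (f ∘ suc) (B - x)) (f (suc x)))
        (trans (cong ((if b then f zero else 0) ℕ.+_) (weight-remove (f ∘ suc) x∈B))
          (sym (weight-∷ f b B))))

  weight-insert : ∀ (f : Fin d → ℕ) B y → y ∉ B → weight f (B ∪ ⁅ y ⁆) ≡ weight f B ℕ.+ f y
  weight-insert f (true ∷ B) zero y∉B = contradiction here y∉B
  weight-insert f (false ∷ B) zero y∉B
    rewrite Subset.∪-identityʳ B | weight-∷ f true B | weight-∷ f false B
    = ℕ.+-comm (f zero) (weight (f ∘ suc) B)
  weight-insert f (b ∷ B) (suc y) y∉B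
    rewrite Bool.∨-identityʳ b | weight-∷ f b (B ∪ ⁅ y ⁆) | weight-∷ f b B
    = trans (cong ((if b then f zero else 0) ℕ.+_)
              (weight-insert (f ∘ suc) B y (y∉B ∘ there)))
        (sym (ℕ.+-assoc (if b then f zero else 0) _ _))

  ∉-remove : ∀ {B : Subset d} {x y} → y ∉ B → y ∉ B - x
  ∉-remove {B = B} {x} y∉B = y∉B ∘ Subset.p─q⊆p B ⁅ x ⁆

  weight-swap : ∀ (f : Fin d → ℕ) {B x y} → x ∈ B → y ∉ B →
                weight f ((B - x) ∪ ⁅ y ⁆) ℕ.+ f x ≡ weight f B ℕ.+ f y
  weight-swap f {B} {x} {y} x∈B y∉B
    rewrite weight-insert f (B - x) y (∉-remove y∉B) | sym (weight-remove f x∈B)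
    = trans (ℕ.+-assoc w _ _) (trans (cong (w ℕ.+_) (ℕ.+-comm (f y) (f x)))
        (sym (ℕ.+-assoc w _ _)))
    where w = weight f (B - x)

  ∈─⁻ : ∀ (p q : Subset d) {x} → x ∈ p ─ q → x ∈ p × x ∉ q
  ∈─⁻ (true  ∷ p) (false ∷ q) here = here , λ ()
  ∈─⁻ (false ∷ p) (false ∷ q) {zero} ()
  ∈─⁻ (_     ∷ p) (true  ∷ q) {zero} ()
  ∈─⁻ (_ ∷ p) (_ ∷ q) (there x∈) with ∈─⁻ p q x∈
  ... | x∈p , x∉q = there x∈p , λ { (there x∈q) → x∉q x∈q }

  argmin-∈ : ∀ (f : Fin d → ℕ) (S : Subset d) → Nonempty S →
             ∃ λ x → x ∈ S × (∀ {y} → y ∈ S → f x ℕ.≤ f y)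
  argmin-∈ f S (x₀ , x₀∈S) = argmin f x₀ (elements S) , x∈S (argmin-sel f x₀ (elements S))
    , λ {y} y∈S → All.lookup (f[argmin]≤f[xs] {f = f} x₀ (elements S))
        (Mem.∈-filter⁺ (_∈? S) (Mem.∈-allFin y) y∈S)
    where
    x∈S : ∀ {x} → x ≡ x₀ ⊎ x ∈ˡ elements S → x ∈ S
    x∈S (inj₁ refl) = x₀∈S
    x∈S (inj₂ x∈)   = proj₂ (Mem.∈-filter⁻ (_∈? S) {xs = allFin _} x∈)

module CompositionLemmas where

  ∈-level⁺ : ∀ (f : Fin d → ℕ) {i k} → f i ≡ k → i ∈ levelSet f k
  ∈-level⁺ f {i} {k} fi≡k = Vec.lookup⇒[]= i _
    (trans (Vec.lookup∘tabulate _ i) (dec-true (f i ℕ.≟ k) fi≡k))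

  ∈-level⁻ : ∀ (f : Fin d → ℕ) {i k} → i ∈ levelSet f k → f i ≡ k
  ∈-level⁻ f {i} {k} i∈ = does-true⁻ (f i ℕ.≟ k)
    (trans (sym (Vec.lookup∘tabulate _ i)) (Vec.[]=⇒lookup i∈))
    where
    does-true⁻ : ∀ {A : Set} (a? : Dec A) → does a? ≡ true → A
    does-true⁻ (yes a) _ = a

  blocks : (Fin d → ℕ) → List ℕ → List (Subset d)
  blocks f ks = filter nonempty? (List.map (levelSet f) ks)

  block⁺ : ∀ (f : Fin d → ℕ) {i ks} → f i ∈ˡ ks → Any (i ∈_) (blocks f ks)
  block⁺ f {i} fi∈ks = Mem.lose
    (Mem.∈-filter⁺ nonempty? (Mem.∈-map⁺ (levelSet f) fi∈ks) (i , ∈-level⁺ f refl))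
    (∈-level⁺ f refl)

  block⁻ : ∀ (f : Fin d → ℕ) {i} ks → Any (i ∈_) (blocks f ks) → f i ∈ˡ ks
  block⁻ f ks any with Mem.find any
  ... | b , b∈ , i∈b with Mem.∈-map⁻ (levelSet f) (proj₁ (Mem.∈-filter⁻ nonempty? b∈))
  ... | k , k∈ks , refl = subst (_∈ˡ ks) (sym (∈-level⁻ f i∈b)) k∈ks

  Before : Fin d → Fin d → List (Subset d) → Set
  Before i j []       = ⊥
  Before i j (b ∷ bs) = (i ∈ b × Any (j ∈_) bs) ⊎ Before i j bs

  before⁺ : ∀ (f : Fin d → ℕ) {i j ks} → AllPairs ℕ._<_ ks → f i ∈ˡ ks → f j ∈ˡ ks →
            f i ℕ.< f j → Before i j (blocks f ks)
  before⁺ f (k< ∷ <ks) (here fi≡k) (here fj≡k) fi<fj =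
    contradiction fi<fj (ℕ.<-irrefl (trans fi≡k (sym fj≡k)))
  before⁺ f (k< ∷ <ks) (there fi∈) (here refl) fi<fj =
    contradiction fi<fj (ℕ.<-asym (All.lookup k< fi∈))
  before⁺ f {i} {ks = k ∷ ks} (k< ∷ <ks) (here fi≡k) (there fj∈) fi<fj
    with nonempty? (levelSet f k)
  ... | yes _     = inj₁ (∈-level⁺ f fi≡k , block⁺ f fj∈)
  ... | no  empty = contradiction (i , ∈-level⁺ f fi≡k) empty
  before⁺ f {ks = k ∷ ks} (k< ∷ <ks) (there fi∈) (there fj∈) fi<fj
    with nonempty? (levelSet f k)
  ... | yes _ = inj₂ (before⁺ f <ks fi∈ fj∈ fi<fj)
  ... | no  _ = before⁺ f <ks fi∈ fj∈ fi<fj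

  before⁻ : ∀ (f : Fin d → ℕ) {i j ks} → AllPairs ℕ._<_ ks → Before i j (blocks f ks) → f i ℕ.< f j
  before⁻ f {ks = k ∷ ks} (k< ∷ <ks) b with nonempty? (levelSet f k) | b
  ... | no  _ | b                  = before⁻ f <ks b
  ... | yes _ | inj₂ b             = before⁻ f <ks b
  ... | yes _ | inj₁ (i∈ , j∈later) =
    subst (ℕ._< _) (sym (∈-level⁻ f i∈)) (All.lookup k< (block⁻ f ks j∈later))

  upTo-< : ∀ n → AllPairs ℕ._<_ (upTo n)
  upTo-< n = AllPairs.applyUpTo⁺₁ id n λ i<j _ → i<j

  value∈ : ∀ (f : Fin d → ℕ) i → f i ∈ˡ upTo (suc (max 0 (List.map f (allFin d))))
  value∈ f i = Mem.∈-upTo⁺ (s≤s (All.lookup (xs≤max 0 _) (Mem.∈-map⁺ f (Mem.∈-allFin i))))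

  sameComposition⇒< : ∀ (f g : Fin d → ℕ) → setComposition f ≡ setComposition g →
                      ∀ {i j} → f i ℕ.< f j → g i ℕ.< g j
  sameComposition⇒< f g f≡g {i} {j} fi<fj = before⁻ g (upTo-< _)
    (subst (Before i j) f≡g (before⁺ f (upTo-< _) (value∈ f i) (value∈ f j) fi<fj))

module GenericLemmas (M : Matroid d) where

  open Matroid M using (exchange)
  open SubsetLemmas

  LocallyStrict : (Fin d → ℕ) → Subset d → Set
  LocallyStrict f B = ∀ {x y} → x ∈ B → y ∉ B → IsBasis M ((B - x) ∪ ⁅ y ⁆) → f y ℕ.< f x

  generic⇒local : ∀ f {B} → Maximizes M f B → (∀ {B′} → Maximizes M f B′ → B ≡ B′) →
                  LocallyStrict f B
  generic⇒local f {B} (_ , max-B) unique {x} {y} x∈B y∉B basis = ℕ.≰⇒> λ fx≤fy →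
    let wB≤wB′ = ℕ.+-cancelʳ-≤ (f x) _ _ (ℕ.≤-trans (ℕ.+-monoʳ-≤ (weight f B) fx≤fy)
                   (ℕ.≤-reflexive (sym (weight-swap f x∈B y∉B))))
        B≡B′   = unique (basis , λ C C-basis → ℕ.≤-trans (max-B C C-basis) wB≤wB′)
    in y∉B (subst (y ∈_) (sym B≡B′) (Subset.q⊆p∪q (B - x) ⁅ y ⁆ (Subset.x∈⁅x⁆ y)))

  local⇒max : ∀ f {B} → IsBasis M B → LocallyStrict f B →
              ∀ B′ → IsBasis M B′ → B ≢ B′ → Acc ℕ._<_ Subset.∣ B′ ─ B ∣ →
              weight f B′ ℕ.< weight f B
  local⇒max f {B} basis local B′ basis′ B≢B′ (acc rec) with nonempty? (B ─ B′)
  ... | no empty = contradiction (Subset.⊆-antisym B⊆B′ B′⊆B) B≢B′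
    where
    B⊆B′ : B ⊆ B′
    B⊆B′ {x} x∈B = decidable-stable (x ∈? B′) λ x∉B′ →
      empty (x , Subset.x∈p∧x∉q⇒x∈p─q x∈B x∉B′)
    B′⊆B : B′ ⊆ B
    B′⊆B {x} x∈B′ = decidable-stable (x ∈? B) λ x∉B →
      let y , y∈B , y∉B′ , _ = exchange basis′ basis x∈B′ x∉B in y∉B′ (B⊆B′ y∈B)
  ... | yes ne with argmin-∈ f (B ─ B′) ne
  ... | x , x∈B─B′ , x-min with ∈─⁻ B B′ x∈B─B′
  ... | x∈B , x∉B′ with exchange basis basis′ x∈B x∉B′
  ... | z , z∈B′ , z∉B , swapped with exchange basis′ basis z∈B′ z∉B
  ... | y , y∈B , y∉B′ , basis″ = conclude (B ≟ˢ B″)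
    where
    B″ = (B′ - z) ∪ ⁅ y ⁆

    fz<fy : f z ℕ.< f y
    fz<fy = ℕ.<-≤-trans (local x∈B z∉B swapped) (x-min (Subset.x∈p∧x∉q⇒x∈p─q y∈B y∉B′))

    wB′<wB″ : weight f B′ ℕ.< weight f B″
    wB′<wB″ = ℕ.+-cancelʳ-< (f z) _ _ (ℕ.<-≤-trans (ℕ.+-monoʳ-< (weight f B′) fz<fy)
      (ℕ.≤-reflexive (sym (weight-swap f z∈B′ y∉B′))))

    z∉B″ : z ∉ B″
    z∉B″ z∈B″ with Subset.x∈p∪q⁻ (B′ - z) ⁅ y ⁆ z∈B″
    ... | inj₁ z∈ = proj₂ (∈─⁻ B′ ⁅ z ⁆ z∈) (Subset.x∈⁅x⁆ z)
    ... | inj₂ z∈ = z∉B (subst (_∈ B) (sym (Subset.x∈⁅y⁆⇒x≡y y z∈)) y∈B)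

    closer : Subset.∣ B″ ─ B ∣ ℕ.< Subset.∣ B′ ─ B ∣
    closer = Subset.p⊂q⇒∣p∣<∣q∣ (inclusion
      , z , Subset.x∈p∧x∉q⇒x∈p─q z∈B′ z∉B , z∉B″ ∘ Subset.p─q⊆p B″ B)
      where
      inclusion : B″ ─ B ⊆ B′ ─ B
      inclusion {w} w∈ with ∈─⁻ B″ B w∈
      ... | w∈B″ , w∉B with Subset.x∈p∪q⁻ (B′ - z) ⁅ y ⁆ w∈B″
      ... | inj₁ w∈B′ = Subset.x∈p∧x∉q⇒x∈p─q (Subset.p─q⊆p B′ ⁅ z ⁆ w∈B′) w∉B
      ... | inj₂ w∈y  = contradiction (subst (_∈ B) (sym (Subset.x∈⁅y⁆⇒x≡y y w∈y)) y∈B) w∉B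

    conclude : Dec (B ≡ B″) → weight f B′ ℕ.< weight f B
    conclude (yes B≡B″) = subst (λ C → weight f B′ ℕ.< weight f C) (sym B≡B″) wB′<wB″
    conclude (no  B≢B″) = ℕ.<-trans wB′<wB″ (local⇒max f basis local B″ basis″ B≢B″ (rec closer))

  local⇒generic : ∀ f {B} → IsBasis M B → LocallyStrict f B → Generic M f
  local⇒generic f {B} basis local = B , (basis , maximal) , unique
    where
    <wB : ∀ B′ → IsBasis M B′ → B ≢ B′ → weight f B′ ℕ.< weight f B
    <wB B′ basis′ B≢B′ = local⇒max f basis local B′ basis′ B≢B′ (<-wellFounded _)

    maximal : ∀ B′ → IsBasis M B′ → weight f B′ ℕ.≤ weight f B
    maximal B′ basis′ with B ≟ˢ B′
    ... | yes refl = ℕ.≤-refl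
    ... | no  B≢B′ = ℕ.<⇒≤ (<wB B′ basis′ B≢B′)

    unique : ∀ {B′} → Maximizes M f B′ → B ≡ B′
    unique {B′} (basis′ , max-B′) = decidable-stable (B ≟ˢ B′) λ B≢B′ →
      ℕ.<⇒≱ (<wB B′ basis′ B≢B′) (max-B′ B basis)

  generic-resp : ∀ f g → setComposition f ≡ setComposition g → Generic M f → Generic M g
  generic-resp f g f≡g (B , max-B , unique) = local⇒generic g (proj₁ max-B)
    λ x∈B y∉B basis → CompositionLemmas.sameComposition⇒< f g f≡g
      (generic⇒local f max-B unique x∈B y∉B basis)

infix 4 _≼_

-- Pointwise also forces B and A to have the same number of elements.
_≼_ : Rel (Subset d) 0ℓ
B ≼ A = Pointwise Fin._≤_ (elements B) (elements A)

module GaleLemmas where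

  open SubsetLemmas

  -- Read from left to right, starting e ahead, B never has had fewer elements
  -- than A, and both end with the same number.
  data Ahead : ℕ → Subset d → Subset d → Set where
    []      : Ahead 0 [] []
    both    : ∀ {e} {B A : Subset d} → Ahead e B A → Ahead e (inside ∷ B) (inside ∷ A)
    neither : ∀ {e} {B A : Subset d} → Ahead e B A → Ahead e (outside ∷ B) (outside ∷ A)
    left    : ∀ {e} {B A : Subset d} → Ahead (suc e) B A → Ahead e (inside ∷ B) (outside ∷ A)
    right   : ∀ {e} {B A : Subset d} → Ahead e B A → Ahead (suc e) (outside ∷ B) (inside ∷ A)

  pos : ℕ → Subset d → List ℕ
  pos k []            = []
  pos k (inside  ∷ B) = k ∷ pos (suc k) B
  pos k (outside ∷ B) = pos (suc k) B

  elements≡pos : ∀ k (B : Subset d) → List.map (λ i → k ℕ.+ toℕ i) (elements B) ≡ pos k B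
  map-suc≡pos : ∀ k (B : Subset d) →
    List.map (λ i → k ℕ.+ toℕ i) (List.map suc (elements B)) ≡ pos (suc k) B

  map-suc≡pos k B = trans (sym (List.map-∘ (elements B)))
    (trans (List.map-cong (λ i → ℕ.+-suc k (toℕ i)) (elements B)) (elements≡pos (suc k) B))

  elements≡pos k [] = refl
  elements≡pos k (inside ∷ B) = trans (cong (List.map _) (elements-in B))
    (cong₂ _∷_ (ℕ.+-identityʳ k) (map-suc≡pos k B))
  elements≡pos k (outside ∷ B) = trans (cong (List.map _) (elements-out B)) (map-suc≡pos k B)

  pos-too-late : ∀ {j k ys} (B : Subset d) → k ℕ.< j → ¬ Pointwise ℕ._≤_ (pos j B) (k ∷ ys)
  pos-too-late (inside  ∷ B) k<j (j≤k ∷ _) = ℕ.<⇒≱ k<j j≤k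
  pos-too-late (outside ∷ B) k<j p         = pos-too-late B (ℕ.m<n⇒m<1+n k<j) p

  snoc : ∀ (Q : List ℕ) k ks → Q ++ k ∷ ks ≡ (Q ++ k ∷ []) ++ ks
  snoc Q k ks = sym (List.++-assoc Q (k ∷ []) ks)

  length-snoc : ∀ (Q : List ℕ) (k : ℕ) → List.length (Q ++ k ∷ []) ≡ suc (List.length Q)
  length-snoc Q k = trans (List.length-++ Q) (ℕ.+-comm _ 1)

  ahead⁺ : ∀ {k} Q (B A : Subset d) → Pointwise ℕ._≤_ (Q ++ pos k B) (pos k A) →
           Ahead (List.length Q) B A
  ahead⁺ [] [] [] p = []
  ahead⁺ [] (inside ∷ B) (inside ∷ A) (_ ∷ p) = both (ahead⁺ [] B A p)
  ahead⁺ {k = k} (q ∷ Q) (inside ∷ B) (inside ∷ A) (_ ∷ p) = both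
    (subst (λ e → Ahead e B A) (length-snoc Q k)
      (ahead⁺ (Q ++ k ∷ []) B A (subst (λ xs → Pointwise ℕ._≤_ xs (pos (suc k) A)) (snoc Q k (pos (suc k) B)) p)))
  ahead⁺ {k = k} Q (inside ∷ B) (outside ∷ A) p = left
    (subst (λ e → Ahead e B A) (length-snoc Q k)
      (ahead⁺ (Q ++ k ∷ []) B A (subst (λ xs → Pointwise ℕ._≤_ xs (pos (suc k) A)) (snoc Q k (pos (suc k) B)) p)))
  ahead⁺ [] (outside ∷ B) (inside ∷ A) p = contradiction p (pos-too-late B ℕ.≤-refl)
  ahead⁺ (q ∷ Q) (outside ∷ B) (inside ∷ A) (_ ∷ p) = right (ahead⁺ Q B A p)
  ahead⁺ Q (outside ∷ B) (outside ∷ A) p = neither (ahead⁺ Q B A p)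

  weaken : ∀ {k Q} → All (ℕ._≤ k) Q → All (ℕ._≤ suc k) Q
  weaken = All.map ℕ.m≤n⇒m≤1+n

  ahead⁻ : ∀ {k e} {B A : Subset d} Q → List.length Q ≡ e → All (ℕ._≤ k) Q →
           Ahead e B A → Pointwise ℕ._≤_ (Q ++ pos k B) (pos k A)
  ahead⁻ [] refl [] [] = []
  ahead⁻ [] refl [] (both a) = ℕ.≤-refl ∷ ahead⁻ [] refl [] a
  ahead⁻ {k = k} (q ∷ Q) refl (q≤k ∷ Q≤k) (both {B = B} {A} a) = q≤k ∷
    subst (λ xs → Pointwise ℕ._≤_ xs (pos (suc k) A)) (sym (snoc Q k (pos (suc k) B)))
      (ahead⁻ {k = suc k} (Q ++ k ∷ []) (length-snoc Q k) (weaken (All.++⁺ Q≤k (ℕ.≤-refl ∷ []))) a)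
  ahead⁻ {k = k} Q refl Q≤k (left {B = B} {A} a) =
    subst (λ xs → Pointwise ℕ._≤_ xs (pos (suc k) A)) (sym (snoc Q k (pos (suc k) B)))
      (ahead⁻ {k = suc k} (Q ++ k ∷ []) (length-snoc Q k) (weaken (All.++⁺ Q≤k (ℕ.≤-refl ∷ []))) a)
  ahead⁻ (q ∷ Q) refl (q≤k ∷ Q≤k) (right a) = q≤k ∷ ahead⁻ Q refl (weaken Q≤k) a
  ahead⁻ Q Q≡e Q≤k (neither a) = ahead⁻ Q Q≡e (weaken Q≤k) a

  ≼⇒ahead : ∀ {B A : Subset d} → B ≼ A → Ahead 0 B A
  ≼⇒ahead {B = B} {A} B≼A = ahead⁺ {k = 0} [] B A
    (subst₂ (Pointwise ℕ._≤_) (elements≡pos 0 B) (elements≡pos 0 A)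
      (Pointwise.map⁺ toℕ toℕ B≼A))

  ahead⇒≼ : ∀ {B A : Subset d} → Ahead 0 B A → B ≼ A
  ahead⇒≼ {B = B} {A} a = Pointwise.map⁻ toℕ toℕ
    (subst₂ (Pointwise ℕ._≤_) (sym (elements≡pos 0 B)) (sym (elements≡pos 0 A))
      (ahead⁻ {k = 0} [] refl [] a))

  ahead-remove : ∀ {e x} {B A : Subset d} → Ahead e B A → x ∈ B → Ahead (suc e) (B - x) A
  ahead-remove (both {B = B} a) here rewrite remove-zero inside B = right a
  ahead-remove (left {B = B} a) here rewrite remove-zero inside B = neither a
  ahead-remove (both a)    (there x∈) = both    (ahead-remove a x∈)
  ahead-remove (neither a) (there x∈) = neither (ahead-remove a x∈)
  ahead-remove (left a)    (there x∈) = left    (ahead-remove a x∈)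
  ahead-remove (right a)   (there x∈) = right   (ahead-remove a x∈)

  Insertion : ℕ → (B C B′ A : Subset d) → Set
  Insertion e B C B′ A = ∃ λ y → y ∈ B′ × y ∉ B × Ahead e (C ∪ ⁅ y ⁆) A

  step : ∀ {e e′ b b′ c a} {B C B′ A : Subset d} →
         (∀ {D} → Ahead e D A → Ahead e′ (c ∷ D) (a ∷ A)) →
         Insertion e B C B′ A → Insertion e′ (b ∷ B) (c ∷ C) (b′ ∷ B′) (a ∷ A)
  step {c = c} build (y , y∈B′ , y∉B , a) = suc y , there y∈B′ , (λ { (there y∈B) → y∉B y∈B })
    , subst (λ c′ → Ahead _ (c′ ∷ _) _) (sym (Bool.∨-identityʳ c)) (build a)

  first : ∀ {e} {B C B′ A : Subset d} {a} → Ahead e (inside ∷ C) (a ∷ A) →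
          Insertion e (outside ∷ B) (outside ∷ C) (inside ∷ B′) (a ∷ A)
  first {C = C} h = zero , here , (λ ())
    , subst (λ D → Ahead _ (inside ∷ D) _) (sym (Subset.∪-identityʳ C)) h

  ahead-insert : ∀ {e e′} {B B′ A : Subset d} → Ahead (suc e) B A → Ahead e′ B′ A → e′ ℕ.≤ e →
                 Insertion e B B B′ A
  ahead-insert (both h)    (both h′)    e′≤e = step both (ahead-insert h h′ e′≤e)
  ahead-insert (neither h) (neither h′) e′≤e = step neither (ahead-insert h h′ e′≤e)
  ahead-insert (left h)    (left h′)    e′≤e = step left (ahead-insert h h′ (s≤s e′≤e))
  ahead-insert (right h)   (right h′)   (s≤s e′≤e) = step right (ahead-insert h h′ e′≤e)
  ahead-insert (both h)    (right h′)   e′≤e =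
    step both (ahead-insert h h′ (ℕ.<⇒≤ e′≤e))
  ahead-insert (left h)    (neither h′) e′≤e =
    step left (ahead-insert h h′ (ℕ.m≤n⇒m≤1+n e′≤e))
  ahead-insert (right h)   (both h′)    e′≤e = first (both h)
  ahead-insert (neither h) (left h′)    e′≤e = first (left h)

  ahead-exchange : ∀ {e e′ x} {B B′ A : Subset d} → Ahead e B A → Ahead e′ B′ A → e′ ℕ.≤ e →
                   x ∈ B → x ∉ B′ → Insertion e B (B - x) B′ A
  ahead-exchange (both h) (both h′) e′≤e here x∉ = contradiction here x∉
  ahead-exchange (left h) (left h′) e′≤e here x∉ = contradiction here x∉
  ahead-exchange (both {B = B} h) (right h′) (s≤s e′≤e) here x∉ rewrite remove-zero inside B =
    step right (ahead-insert h h′ e′≤e)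
  ahead-exchange (left {B = B} h) (neither h′) e′≤e here x∉ rewrite remove-zero inside B =
    step neither (ahead-insert h h′ e′≤e)
  ahead-exchange (both h)    (both h′)    e′≤e (there x∈) x∉ =
    step both (ahead-exchange h h′ e′≤e x∈ (x∉ ∘ there))
  ahead-exchange (neither h) (neither h′) e′≤e (there x∈) x∉ =
    step neither (ahead-exchange h h′ e′≤e x∈ (x∉ ∘ there))
  ahead-exchange (left h)    (left h′)    e′≤e (there x∈) x∉ =
    step left (ahead-exchange h h′ (s≤s e′≤e) x∈ (x∉ ∘ there))
  ahead-exchange (right h)   (right h′)   (s≤s e′≤e) (there x∈) x∉ =
    step right (ahead-exchange h h′ e′≤e x∈ (x∉ ∘ there))
  ahead-exchange (both h)    (right h′)   e′≤e (there x∈) x∉ =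
    step both (ahead-exchange h h′ (ℕ.<⇒≤ e′≤e) x∈ (x∉ ∘ there))
  ahead-exchange (left h)    (neither h′) e′≤e (there x∈) x∉ =
    step left (ahead-exchange h h′ (ℕ.m≤n⇒m≤1+n e′≤e) x∈ (x∉ ∘ there))
  ahead-exchange (right h)   (both h′)    e′≤e (there x∈) x∉ = first (both (ahead-remove h x∈))
  ahead-exchange (neither h) (left h′)    e′≤e (there x∈) x∉ = first (left (ahead-remove h x∈))

SM : Subset d → Matroid d
SM A = record
  { IsBasis  = _≼ A
  ; isBasis? = λ B → Pointwise.decidable Fin._≤?_ (elements B) (elements A)
  ; nonempty = A , Pointwise.refl Fin.≤-refl
  ; exchange = λ B≼A B′≼A x∈B x∉B′ →
      let y , y∈B′ , y∉B , h = ahead-exchange (≼⇒ahead B≼A) (≼⇒ahead B′≼A) ℕ.≤-refl x∈B x∉B′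
      in y , y∈B′ , y∉B , ahead⇒≼ h
  }
  where open GaleLemmas

ℤ≥1 : Set
ℤ≥1 = ∃ λ n → 1 ℕ.≤ n

⌊_⌋ : (Fin d → ℤ≥1) → Fin d → ℕ
⌊ f ⌋ i = proj₁ (f i)

Matroid-setoid : ℕ → Setoid (Level.suc 0ℓ) 0ℓ
Matroid-setoid d = record
  { Carrier = Matroid d
  ; _≈_ = λ M N → ∀ B → IsBasis M B ⇔ IsBasis N B
  ; isEquivalence = record
    { refl  = λ B → ⇔-refl
    ; sym   = λ M≈N B → ⇔-sym (M≈N B)
    ; trans = λ M≈N N≈P B → ⇔-trans (M≈N B) (N≈P B)
    }
  }

module MatroidEquality {M N : Matroid d} (M≈N : ∀ B → IsBasis M B ⇔ IsBasis N B) where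

  maximizes-resp : ∀ {f B} → Maximizes M f B ⇔ Maximizes N f B
  maximizes-resp {B = B} = mk⇔
    (λ (b , h) → Equivalence.to   (M≈N B) b , λ B′ b′ → h B′ (Equivalence.from (M≈N B′) b′))
    (λ (b , h) → Equivalence.from (M≈N B) b , λ B′ b′ → h B′ (Equivalence.to   (M≈N B′) b′))

  generic-resp-≈ : ∀ {f} → Generic M f ⇔ Generic N f
  generic-resp-≈ = mk⇔
    (λ (B , m , u) → B , Equivalence.to   maximizes-resp m , λ m′ → u (Equivalence.from maximizes-resp m′))
    (λ (B , m , u) → B , Equivalence.from maximizes-resp m , λ m′ → u (Equivalence.to   maximizes-resp m′))

-- The free module on a setoid S, given by generators and relations: ⟨_⟩ sends
-- S to a basis.
module Free {r ℓr s ℓs} (R : Ring r ℓr) (S : Setoid s ℓs) where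

  private
    module R = Ring R
    module S = Setoid S

  infixl 6 _⊕_
  infixr 7 _⊙_
  infix  8 ⊖_
  infix  4 _≋_

  data Term : Set (r Level.⊔ s) where
    ⟨_⟩ : S.Carrier → Term
    𝟎   : Term
    _⊕_ : Term → Term → Term
    ⊖_  : Term → Term
    _⊙_ : R.Carrier → Term → Term

  data _≋_ : Term → Term → Set (r Level.⊔ ℓr Level.⊔ s Level.⊔ ℓs) where
    ⟨⟩-cong   : ∀ {a b} → a S.≈ b → ⟨ a ⟩ ≋ ⟨ b ⟩
    ≋-refl    : ∀ {x} → x ≋ x
    ≋-sym     : ∀ {x y} → x ≋ y → y ≋ x
    ≋-trans   : ∀ {x y z} → x ≋ y → y ≋ z → x ≋ z
    ⊕-cong    : ∀ {x x′ y y′} → x ≋ x′ → y ≋ y′ → x ⊕ y ≋ x′ ⊕ y′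
    ⊖-cong    : ∀ {x y} → x ≋ y → ⊖ x ≋ ⊖ y
    ⊙-cong    : ∀ {b c x y} → b R.≈ c → x ≋ y → b ⊙ x ≋ c ⊙ y
    ⊕-assoc   : ∀ x y z → (x ⊕ y) ⊕ z ≋ x ⊕ (y ⊕ z)
    ⊕-comm    : ∀ x y → x ⊕ y ≋ y ⊕ x
    ⊕-idˡ     : ∀ x → 𝟎 ⊕ x ≋ x
    ⊖-invˡ    : ∀ x → ⊖ x ⊕ x ≋ 𝟎
    ⊙-zeroˡ   : ∀ x → R.0# ⊙ x ≋ 𝟎
    ⊙-zeroʳ   : ∀ c → c ⊙ 𝟎 ≋ 𝟎
    ⊙-oneˡ    : ∀ x → R.1# ⊙ x ≋ x
    ⊙-assoc   : ∀ b c x → (b R.* c) ⊙ x ≋ b ⊙ (c ⊙ x)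
    ⊙-distribʳ : ∀ x b c → (b R.+ c) ⊙ x ≋ b ⊙ x ⊕ c ⊙ x
    ⊙-distribˡ : ∀ c x y → c ⊙ (x ⊕ y) ≋ c ⊙ x ⊕ c ⊙ y

  freeModule : LeftModule R _ _
  freeModule = record
    { Carrierᴹ = Term
    ; _≈ᴹ_ = _≋_
    ; _+ᴹ_ = _⊕_
    ; _*ₗ_ = _⊙_
    ; 0ᴹ = 𝟎
    ; -ᴹ_ = ⊖_
    ; isLeftModule = record
      { isLeftSemimodule = record
        { +ᴹ-isCommutativeMonoid = record
          { isMonoid = record
            { isSemigroup = record
              { isMagma = record
                { isEquivalence = record { refl = ≋-refl ; sym = ≋-sym ; trans = ≋-trans }
                ; ∙-cong = ⊕-cong
                }
              ; assoc = ⊕-assoc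
              }
            ; identity = ⊕-idˡ , λ x → ≋-trans (⊕-comm x 𝟎) (⊕-idˡ x)
            }
          ; comm = ⊕-comm
          }
        ; isPreleftSemimodule = record
          { *ₗ-cong      = ⊙-cong
          ; *ₗ-zeroˡ     = ⊙-zeroˡ
          ; *ₗ-distribʳ  = ⊙-distribʳ
          ; *ₗ-identityˡ = ⊙-oneˡ
          ; *ₗ-assoc     = ⊙-assoc
          ; *ₗ-zeroʳ     = ⊙-zeroʳ
          ; *ₗ-distribˡ  = ⊙-distribˡ
          }
        }
      ; -ᴹ‿cong    = ⊖-cong
      ; -ᴹ‿inverse = ⊖-invˡ , λ x → ≋-trans (⊕-comm x (⊖ x)) (⊖-invˡ x)
      }
    }

  module LinearExtension {m ℓm} (M : LeftModule R m ℓm)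
    (φ : S.Carrier → LeftModule.Carrierᴹ M)
    (φ-cong : ∀ {a b} → a S.≈ b → LeftModule._≈ᴹ_ M (φ a) (φ b)) where

    private module M = LeftModule M

    extend : Term → M.Carrierᴹ
    extend ⟨ a ⟩   = φ a
    extend 𝟎       = M.0ᴹ
    extend (x ⊕ y) = extend x M.+ᴹ extend y
    extend (⊖ x)   = M.-ᴹ extend x
    extend (c ⊙ x) = c M.*ₗ extend x

    extend-cong : ∀ {x y} → x ≋ y → extend x M.≈ᴹ extend y
    extend-cong (⟨⟩-cong a≈b)      = φ-cong a≈b
    extend-cong ≋-refl             = M.≈ᴹ-refl
    extend-cong (≋-sym p)          = M.≈ᴹ-sym (extend-cong p)
    extend-cong (≋-trans p q)      = M.≈ᴹ-trans (extend-cong p) (extend-cong q)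
    extend-cong (⊕-cong p q)       = M.+ᴹ-cong (extend-cong p) (extend-cong q)
    extend-cong (⊖-cong p)         = M.-ᴹ‿cong (extend-cong p)
    extend-cong (⊙-cong b≈c p)     = M.*ₗ-cong b≈c (extend-cong p)
    extend-cong (⊕-assoc x y z)    = M.+ᴹ-assoc _ _ _
    extend-cong (⊕-comm x y)       = M.+ᴹ-comm _ _
    extend-cong (⊕-idˡ x)          = M.+ᴹ-identityˡ _
    extend-cong (⊖-invˡ x)         = M.-ᴹ‿inverseˡ _
    extend-cong (⊙-zeroˡ x)        = M.*ₗ-zeroˡ _
    extend-cong (⊙-zeroʳ c)        = M.*ₗ-zeroʳ _
    extend-cong (⊙-oneˡ x)         = M.*ₗ-identityˡ _
    extend-cong (⊙-assoc b c x)    = M.*ₗ-assoc _ _ _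
    extend-cong (⊙-distribʳ x b c) = M.*ₗ-distribʳ _ _ _
    extend-cong (⊙-distribˡ c x y) = M.*ₗ-distribˡ _ _ _

    extend-isLeftModuleHomomorphism : LeftModuleMorphisms.IsLeftModuleHomomorphism
      (LeftModule.rawLeftModule freeModule) M.rawLeftModule extend
    extend-isLeftModuleHomomorphism = record
      { +ᴹ-isGroupHomomorphism = record
        { isMonoidHomomorphism = record
          { isMagmaHomomorphism = record
            { isRelHomomorphism = record { cong = extend-cong }
            ; homo = λ x y → M.≈ᴹ-refl
            }
          ; ε-homo = M.≈ᴹ-refl
          }
        ; ⁻¹-homo = λ x → M.≈ᴹ-refl
        }
      ; *ₗ-homo = λ c x → M.≈ᴹ-refl
      }

-- Nothing here depends on the scalars; at the end they are specialised to ℝ.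
module Linear {c ℓ} (K : CommutativeRing c ℓ) where

  private module K = CommutativeRing K

  -- The formal series Σ_f c_f w_f is represented by its coefficients c_f; the
  -- words w_f of distinct f are distinct.
  record WQSym (d : ℕ) : Set (c Level.⊔ ℓ) where
    field
      coeff     : (Fin d → ℤ≥1) → K.Carrier
      invariant : ∀ f g → setComposition ⌊ f ⌋ ≡ setComposition ⌊ g ⌋ → coeff f K.≈ coeff g

  open WQSym public

  WQSym-space : (d : ℕ) → LeftModule K.ring (c Level.⊔ ℓ) ℓ
  WQSym-space d = record
    { Carrierᴹ = WQSym d
    ; _≈ᴹ_ = λ p q → ∀ f → coeff p f K.≈ coeff q f
    ; _+ᴹ_ = λ p q → record
      { coeff     = λ f → coeff p f K.+ coeff q f
      ; invariant = λ f g f≡g → K.+-cong (invariant p f g f≡g) (invariant q f g f≡g)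
      }
    ; _*ₗ_ = λ c p → record
      { coeff     = λ f → c K.* coeff p f
      ; invariant = λ f g f≡g → K.*-cong (K.refl {c}) (invariant p f g f≡g)
      }
    ; 0ᴹ = record { coeff = λ _ → K.0# ; invariant = λ _ _ _ → K.refl }
    ; -ᴹ_ = λ p → record
      { coeff     = λ f → K.- coeff p f
      ; invariant = λ f g f≡g → K.-‿cong (invariant p f g f≡g)
      }
    ; isLeftModule = record
      { isLeftSemimodule = record
        { +ᴹ-isCommutativeMonoid = record
          { isMonoid = record
            { isSemigroup = record
              { isMagma = record
                { isEquivalence = record
                  { refl  = λ f → K.refl
                  ; sym   = λ p≈q f → K.sym (p≈q f)
                  ; trans = λ p≈q q≈r f → K.trans (p≈q f) (q≈r f)
                  }
                ; ∙-cong = λ p≈p′ q≈q′ f → K.+-cong (p≈p′ f) (q≈q′ f)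
                }
              ; assoc = λ p q r f → K.+-assoc (coeff p f) (coeff q f) (coeff r f)
              }
            ; identity = (λ p f → K.+-identityˡ (coeff p f)) , (λ p f → K.+-identityʳ (coeff p f))
            }
          ; comm = λ p q f → K.+-comm (coeff p f) (coeff q f)
          }
        ; isPreleftSemimodule = record
          { *ₗ-cong      = λ c≈c′ p≈p′ f → K.*-cong c≈c′ (p≈p′ f)
          ; *ₗ-zeroˡ     = λ p f → K.zeroˡ (coeff p f)
          ; *ₗ-distribʳ  = λ p b c f → K.distribʳ (coeff p f) b c
          ; *ₗ-identityˡ = λ p f → K.*-identityˡ (coeff p f)
          ; *ₗ-assoc     = λ b c p f → K.*-assoc b c (coeff p f)
          ; *ₗ-zeroʳ     = λ c f → K.zeroʳ c
          ; *ₗ-distribˡ  = λ c p q f → K.distribˡ c (coeff p f) (coeff q f)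
          }
        }
      ; -ᴹ‿cong    = λ p≈q f → K.-‿cong (p≈q f)
      ; -ᴹ‿inverse = (λ p f → K.-‿inverseˡ (coeff p f)) , (λ p f → K.-‿inverseʳ (coeff p f))
      }
    }

  Ψ : Matroid d → WQSym d
  Ψ M = record
    { coeff     = λ f → if does (generic? M ⌊ f ⌋) then K.1# else K.0#
    ; invariant = λ f g f≡g → K.reflexive (cong (if_then K.1# else K.0#)
        (does-⇔ (mk⇔ (generic-resp ⌊ f ⌋ ⌊ g ⌋ f≡g) (generic-resp ⌊ g ⌋ ⌊ f ⌋ (sym f≡g)))
          (generic? M ⌊ f ⌋) (generic? M ⌊ g ⌋)))
    }
    where open GenericLemmas M

  Ψ-cong : ∀ {M N : Matroid d} → (∀ B → IsBasis M B ⇔ IsBasis N B) →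
           ∀ f → coeff (Ψ M) f K.≈ coeff (Ψ N) f
  Ψ-cong {M = M} {N} M≈N f = K.reflexive (cong (if_then K.1# else K.0#)
    (does-⇔ (MatroidEquality.generic-resp-≈ {M = M} {N} M≈N) (generic? M ⌊ f ⌋) (generic? N ⌊ f ⌋)))

  Mat-space : (d : ℕ) → LeftModule K.ring _ _
  Mat-space d = Free.freeModule K.ring (Matroid-setoid d)

  Mat : ℕ → Set _
  Mat d = LeftModule.Carrierᴹ (Mat-space d)

  Ψ-linear : (d : ℕ) → Mat d → WQSym d
  Ψ-linear d = Free.LinearExtension.extend K.ring (Matroid-setoid d) (WQSym-space d)
    Ψ (λ {M} {N} → Ψ-cong {M = M} {N})

  Ψ-linear-isLeftModuleHomomorphism : (d : ℕ) → LeftModuleMorphisms.IsLeftModuleHomomorphism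
    (LeftModule.rawLeftModule (Mat-space d)) (LeftModule.rawLeftModule (WQSym-space d)) (Ψ-linear d)
  Ψ-linear-isLeftModuleHomomorphism d = Free.LinearExtension.extend-isLeftModuleHomomorphism
    K.ring (Matroid-setoid d) (WQSym-space d) Ψ (λ {M} {N} → Ψ-cong {M = M} {N})

  module _ {m ℓm} (V : LeftModule K.ring m ℓm) where

    open LeftModule V

    LinearlyIndependent : ∀ {n} → Vector Carrierᴹ n → Set _
    LinearlyIndependent {n} v = (c : Vector K.Carrier n) →
      sum +ᴹ-rawMonoid (λ i → c i *ₗ v i) ≈ᴹ 0ᴹ → ∀ i → c i K.≈ K.0#

    DimensionAtLeast : ∀ {p} → ℕ → Pred Carrierᴹ p → Set _
    DimensionAtLeast n P =
      ∃ λ (v : Vector Carrierᴹ n) → (∀ i → P (v i)) × LinearlyIndependent v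

    Image : ∀ {a} {A : Set a} → (A → Carrierᴹ) → Pred Carrierᴹ _
    Image φ w = ∃ λ x → φ x ≈ᴹ w

open Linear ℝ-commutativeRing public

{-# OPTIONS --safe #-}

-- Let A be a subset of [d] that is not an initial segment, p its first gap, and
-- f_v the function with value 3 on A, v at p and 1 elsewhere.  The coefficients
-- of Ψ(SM(A′)) at f₂ and f₃ agree unless A contains a basis of SM(A′): otherwise
-- a basis avoiding p has an element outside A, hence beyond p, and exchanging it
-- for p increases the weight, so that every maximal basis contains p.  For A′ = A
-- they differ: A is the only maximal basis for f₂, while for f₃ an element of A
-- beyond p may be exchanged for p.  If A contains a basis of SM(A′), then A is
-- lexicographically at least A′, so the matrix of these differences is
-- unitriangular.  The initial segments contribute one more function, which is
-- separated from the others by a constant f.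
module Submission where

open import Defs
open import Data.Nat.Base using (ℕ; _^_; _∸_)
open import Data.Fin.Subset using (Subset)
open import Data.Product using (∃; _×_)
open import Data.Vec.Functional using (Vector)

open import Algebra.Bundles using (CommutativeRing)
import Algebra.Definitions.RawMonoid as RawMonoid
open import Algebra.Module.Bundles using (LeftModule)
import Algebra.Properties.CommutativeMonoid.Sum as CommutativeMonoid
import Algebra.Properties.Group as Group
open import Data.Bool.Base using (if_then_else_)
open import Data.Fin.Base as Fin using (Fin; zero; suc; punchIn)
import Data.Fin.Induction as Fin
import Data.Fin.Properties as Fin
open import Data.Fin.Subset
  using (inside; outside; _∈_; _∉_; _⊆_; _∪_; _─_; _-_; ⁅_⁆; ⊤; Nonempty)
import Data.Fin.Subset.Properties as Subset
open import Data.Fin.Subset.Properties using (_∈?_)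
open import Data.List.Base as List using (List; []; _∷_; _++_)
import Data.List.Membership.Propositional.Properties as Mem
import Data.List.Properties as List
open import Data.List.Relation.Unary.All as All using (All; []; _∷_)
import Data.List.Relation.Unary.All.Properties as All
open import Data.List.Relation.Unary.AllPairs as AllPairs using (AllPairs; []; _∷_)
import Data.List.Relation.Unary.AllPairs.Properties as AllPairs
open import Data.Nat.Base as ℕ using (zero; suc; z≤n; s≤s; _+_)
import Data.Nat.Properties as ℕ
open import Data.Nat.Solver using (module +-*-Solver)
open import Data.Product using (_,_; proj₁; proj₂)
open import Data.Sum.Base as Sum using (_⊎_; inj₁; inj₂)
open import Data.Vec.Base using ([]; _∷_; here; there)
open import Data.Vec.Functional using (updateAt)
open import Data.Vec.Functional.Properties using (updateAt-updates; updateAt-minimal)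
open import Function.Base using (_∘_; const)
open import Function.Bundles using (_⇔_; mk⇔)
open import Induction.WellFounded using (Acc; acc)
open import Level using (0ℓ) renaming (suc to lsuc)
open import Relation.Binary.Definitions using (tri<; tri≈; tri>)
open import Relation.Binary.PropositionalEquality
open import Relation.Nullary using (¬_; yes; no; does; contradiction)
open import Relation.Nullary.Decidable using (decidable-stable; dec-true; dec-false; does-⇔)
open import Relation.Unary using (Pred)

private variable
  d n : ℕ
  A B : Subset d

-- Spanning sets and first gaps.

Spans : Subset d → Matroid d → Set
Spans A M = ∃ λ B → B ⊆ A × IsBasis M B

FirstGap : Subset d → Fin d → Set
FirstGap A p = p ∉ A × (∀ {x} → x ∉ A → p Fin.≤ x)

NonInitial : Subset d → Set
NonInitial A = ∃ λ p → FirstGap A p × ∃ λ j → j ∈ A × p Fin.< j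

⊆-or-∉ : ∀ (A B : Subset d) → (B ⊆ A) ⊎ (∃ λ x → x ∈ B × x ∉ A)
⊆-or-∉ A B with Subset.nonempty? (B ─ A)
... | yes (x , x∈) = inj₂ (x , SubsetLemmas.∈─⁻ B A x∈)
... | no  empty    = inj₁ λ {x} x∈B → decidable-stable (x ∈? A) λ x∉A →
  empty (x , Subset.x∈p∧x∉q⇒x∈p─q x∈B x∉A)

-- Exchanging an element of `A` missing from `B` would bring in an element of `B` outside `A`.
basis-⊆⇒≡ : ∀ (M : Matroid d) → IsBasis M A → IsBasis M B → B ⊆ A → B ≡ A
basis-⊆⇒≡ {A = A} {B} M a b B⊆A with ⊆-or-∉ B A
... | inj₁ A⊆B = Subset.⊆-antisym B⊆A A⊆B
... | inj₂ (x , x∈A , x∉B) with Matroid.exchange M a b x∈A x∉B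
... | y , y∈B , y∉A , _ = contradiction (B⊆A y∈B) y∉A

-- Schubert matroids: lowering an element of a basis, and spanning read position by position.

module _ where

  open GaleLemmas
  open SubsetLemmas

  insert-first : ∀ {e} {A : Subset (suc d)} → Ahead e (inside ∷ B) A →
                 Ahead e ((outside ∷ B) ∪ ⁅ zero ⁆) A
  insert-first {B = B} {e} {A} = subst (λ C → Ahead e (inside ∷ C) A) (sym (Subset.∪-identityʳ B))

  -- Moving an element from `x` to the earlier `p` raises the lead of `B` by one between the two
  -- positions and leaves it unchanged elsewhere, so the lead never becomes negative.
  ahead-lower : ∀ {e} {p x : Fin d} → Ahead e B A → x ∈ B → p ∉ B → p Fin.< x →
                Ahead e ((B - x) ∪ ⁅ p ⁆) A
  ahead-lower {p = zero} (both h) _ p∉ _ = contradiction here p∉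
  ahead-lower {p = zero} (left h) _ p∉ _ = contradiction here p∉
  ahead-lower {p = zero} (neither h) (there x∈) p∉ p<x =
    insert-first (left (ahead-remove h x∈))
  ahead-lower {p = zero} (right h) (there x∈) p∉ p<x =
    insert-first (both (ahead-remove h x∈))
  ahead-lower {p = suc p} (both h) (there x∈) p∉ (s≤s p<x) = both (ahead-lower h x∈ (p∉ ∘ there) p<x)
  ahead-lower {p = suc p} (left h) (there x∈) p∉ (s≤s p<x) = left (ahead-lower h x∈ (p∉ ∘ there) p<x)
  ahead-lower {p = suc p} (right h) (there x∈) p∉ (s≤s p<x) = right (ahead-lower h x∈ (p∉ ∘ there) p<x)
  ahead-lower {p = suc p} (neither h) (there x∈) p∉ (s≤s p<x) = neither (ahead-lower h x∈ (p∉ ∘ there) p<x)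

  ≼-lower : ∀ {p x : Fin d} → B ≼ A → x ∈ B → p ∉ B → p Fin.< x → (B - x) ∪ ⁅ p ⁆ ≼ A
  ≼-lower B≼A x∈ p∉ p<x = ahead⇒≼ (ahead-lower (≼⇒ahead B≼A) x∈ p∉ p<x)

  -- With the next two lemmas this compares sets lexicographically. The lead starts at 0, so a basis
  -- must contain the first position whenever `B` does, and it cannot contain it when `A` does not.
  spans-outside : Spans (outside ∷ A) (SM (outside ∷ B)) → Spans A (SM B)
  spans-outside {B = B} (c ∷ C , C⊆ , C≼) with ≼⇒ahead {B = c ∷ C} {outside ∷ B} C≼
  ... | neither h = C , Subset.drop-∷-⊆ C⊆ , ahead⇒≼ h
  ... | left h with () ← C⊆ here

  spans-inside : Spans (inside ∷ A) (SM (inside ∷ B)) → Spans A (SM B)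
  spans-inside {B = B} (c ∷ C , C⊆ , C≼) with ≼⇒ahead {B = c ∷ C} {inside ∷ B} C≼
  ... | both h = C , Subset.drop-∷-⊆ C⊆ , ahead⇒≼ h

  outside-¬spans-inside : ¬ Spans (outside ∷ A) (SM (inside ∷ B))
  outside-¬spans-inside {B = B} (c ∷ C , C⊆ , C≼) with ≼⇒ahead {B = c ∷ C} {inside ∷ B} C≼
  ... | both h with () ← C⊆ here

≼-refl : ∀ {A : Subset d} → A ≼ A
≼-refl {A = A} = proj₂ (Matroid.nonempty (SM A))

generic⇒∃local : ∀ (M : Matroid d) {f} → Generic M f →
                 ∃ λ B → IsBasis M B × GenericLemmas.LocallyStrict M f B
generic⇒∃local M {f} (B , max , unique) = B , proj₁ max , GenericLemmas.generic⇒local M f max unique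

-- Test functions attached to a set and its first gap.

one two three : ℤ≥1
one   = 1 , s≤s z≤n
two   = 2 , s≤s z≤n
three = 3 , s≤s z≤n

module _ (A : Subset d) where

  private
    base : Fin d → ℤ≥1
    base i = if does (i ∈? A) then three else one

    base-∈ : ∀ {x} → x ∈ A → base x ≡ three
    base-∈ {x} x∈A = cong (if_then three else one) (dec-true (x ∈? A) x∈A)

    base-∉ : ∀ {x} → x ∉ A → base x ≡ one
    base-∉ {x} x∉A = cong (if_then three else one) (dec-false (x ∈? A) x∉A)

  height : Fin d → ℤ≥1 → Fin d → ℤ≥1
  height p v = updateAt base p (const v)

  module _ {p : Fin d} where

    height-at : ∀ v → ⌊ height p v ⌋ p ≡ proj₁ v
    height-at v = cong proj₁ (updateAt-updates p base)

    height-off : ∀ v w {x} → x ≢ p → ⌊ height p v ⌋ x ≡ ⌊ height p w ⌋ x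
    height-off v w {x} x≢p = cong proj₁ (trans (updateAt-minimal x p base x≢p)
      (sym (updateAt-minimal x p base x≢p)))

    height-∈ : p ∉ A → ∀ v {x} → x ∈ A → ⌊ height p v ⌋ x ≡ 3
    height-∈ p∉A v {x} x∈A = cong proj₁
      (trans (updateAt-minimal x p base λ { refl → p∉A x∈A }) (base-∈ x∈A))

    height-∉ : ∀ v {x} → x ∉ A → x ≢ p → ⌊ height p v ⌋ x ≡ 1
    height-∉ v {x} x∉A x≢p = cong proj₁ (trans (updateAt-minimal x p base x≢p) (base-∉ x∉A))

  -- If A does not span SM A′, a basis avoiding p has an element outside A,
  -- which is later than p and can be exchanged for p: a maximal basis contains
  -- p, and the exact height of p does not matter.
  height-irrelevant : ∀ {A′ p} v w → FirstGap A p → ¬ Spans A (SM A′) →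
                      1 ℕ.< proj₁ v → proj₁ v ℕ.≤ 3 → 1 ℕ.< proj₁ w →
                      Generic (SM A′) ⌊ height p v ⌋ → Generic (SM A′) ⌊ height p w ⌋
  height-irrelevant {A′} {p} v w (p∉A , p≤) ¬spans 1<v v≤3 1<w generic
    with generic⇒∃local (SM A′) {⌊ height p v ⌋} generic
  ... | B , basis , local = GenericLemmas.local⇒generic (SM A′) ⌊ height p w ⌋ {B} basis
        λ {x} {y} x∈B y∉B basis′ → order-kept (λ { refl → y∉B p∈B }) (local x∈B y∉B basis′)
    where
    p∈B : p ∈ B
    p∈B with p ∈? B | ⊆-or-∉ A B
    ... | yes p∈B | _        = p∈B
    ... | no  _   | inj₁ B⊆A = contradiction (B , (λ {_} → B⊆A) , basis) ¬spans
    ... | no  p∉B | inj₂ (x , x∈B , x∉A) = contradiction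
      (subst₂ ℕ._<_ (height-at v) (height-∉ v x∉A x≢p)
        (local x∈B p∉B (≼-lower basis x∈B p∉B (Fin.≤∧≢⇒< (p≤ x∉A) (x≢p ∘ sym)))))
      (ℕ.<-asym 1<v)
      where
      x≢p : x ≢ p
      x≢p refl = p∉B x∈B

    order-kept : ∀ {x y} → y ≢ p → ⌊ height p v ⌋ y ℕ.< ⌊ height p v ⌋ x →
                 ⌊ height p w ⌋ y ℕ.< ⌊ height p w ⌋ x
    -- As `p` lies in `B`, the incoming `y` is never `p`, so only the case `x = p` depends on the
    -- height. There `y` cannot be in `A`, where the value is already 3, so it has value 1.
    order-kept {x} {y} y≢p lt with x Fin.≟ p
    ... | no  x≢p = subst₂ ℕ._<_ (height-off v w y≢p) (height-off v w x≢p) lt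
    ... | yes refl with y ∈? A
    ...   | yes y∈A = contradiction
            (subst₂ ℕ._<_ (height-∈ p∉A v y∈A) (height-at v) lt) (ℕ.≤⇒≯ v≤3)
    ...   | no  y∉A = subst₂ ℕ._<_ (sym (height-∉ w y∉A y≢p)) (sym (height-at w)) 1<w

  -- Elements of `A` have value 3 and all others at most 2, so every exchange out of `A` loses
  -- weight.
  height-two-generic : ∀ {p} → p ∉ A → Generic (SM A) ⌊ height p two ⌋
  height-two-generic {p} p∉A = GenericLemmas.local⇒generic (SM A) ⌊ height p two ⌋ {A} ≼-refl
    λ {x} {y} x∈A y∉A _ → subst (_ ℕ.<_) (sym (height-∈ p∉A two x∈A)) (s≤s (below y∉A))
    where
    below : ∀ {y} → y ∉ A → ⌊ height p two ⌋ y ℕ.≤ 2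
    below {y} y∉A with y Fin.≟ p
    ... | yes refl = ℕ.≤-reflexive (height-at two)
    ... | no  y≢p  = ℕ.≤-trans (ℕ.≤-reflexive (height-∉ two y∉A y≢p)) (s≤s z≤n)

  height-three-¬generic : ∀ {p j} → p ∉ A → j ∈ A → p Fin.< j → ¬ Generic (SM A) ⌊ height p three ⌋
  height-three-¬generic {p} {j} p∉A j∈A p<j generic
    with generic⇒∃local (SM A) {⌊ height p three ⌋} generic
  ... | B , basis , local with ⊆-or-∉ A B
  -- Exchanging `x` for an element of `A` brings in the largest possible value 3, which contradicts
  -- strictness.
  ...   | inj₂ (x , x∈B , x∉A) with Matroid.exchange (SM A) basis ≼-refl x∈B x∉A
  ...     | y , y∈A , y∉B , basis′ = contradiction
            (subst (ℕ._< _) (height-∈ p∉A three y∈A) (local x∈B y∉B basis′)) (ℕ.≤⇒≯ (≤3 x))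
    where
    ≤3 : ∀ x → ⌊ height p three ⌋ x ℕ.≤ 3
    ≤3 x with x ∈? A | x Fin.≟ p
    ... | yes x∈A | _        = ℕ.≤-reflexive (height-∈ p∉A three x∈A)
    ... | no  _   | yes refl = ℕ.≤-reflexive (height-at three)
    ... | no  x∉A | no  x≢p  = ℕ.≤-trans (ℕ.≤-reflexive (height-∉ three x∉A x≢p)) (s≤s z≤n)
  height-three-¬generic {p} {j} p∉A j∈A p<j generic
      | B , basis , local | inj₁ B⊆A with basis-⊆⇒≡ (SM A) ≼-refl basis B⊆A
  -- Now `B` is `A`, and exchanging `j` for `p` gives a basis of the same weight, since both have
  -- value 3.
  ...   | refl = ℕ.<-irrefl (trans (height-at three) (sym (height-∈ p∉A three j∈A)))
                   (local j∈A p∉A (≼-lower basis j∈A p∉A p<j))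

-- The full set, and separation of one matroid from a family.

⊤-generic : ∀ f → Generic (SM (⊤ {n = d})) f
⊤-generic f = GenericLemmas.local⇒generic (SM ⊤) f {⊤} ≼-refl
  λ x∈⊤ y∉⊤ _ → contradiction Subset.∈⊤ y∉⊤

⊤-spans : ∀ (M : Matroid d) → Spans ⊤ M
⊤-spans M = let B , basis = Matroid.nonempty M in B , Subset.⊆⊤ {p = B} , basis

-- A difference of two coefficients, or a single one, that takes the value 1 at
-- M and vanishes at every N in P.
Separated : Matroid d → Pred (Matroid d) (lsuc 0ℓ) → Set₁
Separated M P = ∃ λ f → Generic M ⌊ f ⌋ ×
  ((∀ {N} → P N → ¬ Generic N ⌊ f ⌋) ⊎
   (∃ λ g → ¬ Generic M ⌊ g ⌋ × (∀ {N} → P N → Generic N ⌊ f ⌋ ⇔ Generic N ⌊ g ⌋)))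

separated-⊆ : ∀ (M : Matroid d) {P Q : Pred (Matroid d) (lsuc 0ℓ)} →
              Separated M P → (∀ {N} → Q N → P N) → Separated M Q
separated-⊆ M (f , generic , inj₁ ¬P) Q⊆P = f , generic , inj₁ (¬P ∘ Q⊆P)
separated-⊆ M (f , generic , inj₂ (g , ¬generic , P⇔)) Q⊆P =
  f , generic , inj₂ (g , ¬generic , P⇔ ∘ Q⊆P)

off-diagonal : ∀ {ℓ} {P : Pred (Fin n) ℓ} {i} → (∀ j → j Fin.< i → P j) → (∀ j → i Fin.< j → P j) →
               ∀ j → j ≢ i → P j
off-diagonal {i = i} below above j j≢i with Fin.<-cmp j i
... | tri< j<i _ _ = below j j<i
... | tri≈ _ j≡i _ = contradiction j≡i j≢i
... | tri> _ _ i<j = above j i<j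

-- From separation to linear independence, over any commutative ring.

module _ {c ℓ} (K : CommutativeRing c ℓ) where

  private
    module K = CommutativeRing K
    module L = Linear K
  open CommutativeMonoid K.+-commutativeMonoid using (sum; sum-remove; sum-cong-≋; sum-replicate-zero)
  open import Relation.Binary.Reasoning.Setoid K.setoid

  -- Isolates one term of a linear relation evaluated at two functions, once all other terms are
  -- known to match.
  sum-cancel : ∀ (i : Fin n) (u w : Vector K.Carrier n) → (∀ j → j ≢ i → u j K.≈ w j) →
               sum u K.≈ sum w → u i K.≈ w i
  sum-cancel {n = suc n} i u w u≈w Σu≈Σw = Group.∙-cancelʳ K.+-group _ _ _ (begin
    u i K.+ sum (u ∘ punchIn i)  ≈⟨ sum-remove u ⟨
    sum u                        ≈⟨ Σu≈Σw ⟩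
    sum w                        ≈⟨ sum-remove w ⟩
    w i K.+ sum (w ∘ punchIn i)  ≈⟨ K.+-congˡ (sum-cong-≋ λ j → u≈w _ (Fin.punchInᵢ≢i i j)) ⟨
    w i K.+ sum (u ∘ punchIn i)  ∎)

  private
    linearSum : Vector (L.WQSym d) n → L.WQSym d
    linearSum {d = d} = RawMonoid.sum (LeftModule.+ᴹ-rawMonoid (L.WQSym-space d))

  coeff-sum : ∀ (v : Vector (L.WQSym d) n) f →
              L.coeff (linearSum v) f ≡ sum (λ i → L.coeff (v i) f)
  coeff-sum {n = zero}  v f = refl
  coeff-sum {n = suc n} v f = cong (L.coeff (v zero) f K.+_) (coeff-sum (v ∘ suc) f)

  coeff-generic : ∀ (M : Matroid d) f → Generic M ⌊ f ⌋ → L.coeff (L.Ψ M) f ≡ K.1#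
  coeff-generic M f g = cong (if_then K.1# else K.0#) (dec-true (generic? M ⌊ f ⌋) g)

  coeff-¬generic : ∀ (M : Matroid d) f → ¬ Generic M ⌊ f ⌋ → L.coeff (L.Ψ M) f ≡ K.0#
  coeff-¬generic M f ¬g = cong (if_then K.1# else K.0#) (dec-false (generic? M ⌊ f ⌋) ¬g)

  coeff-⇔ : ∀ (M : Matroid d) f g → Generic M ⌊ f ⌋ ⇔ Generic M ⌊ g ⌋ →
            L.coeff (L.Ψ M) f ≡ L.coeff (L.Ψ M) g
  coeff-⇔ M f g f⇔g = cong (if_then K.1# else K.0#)
    (does-⇔ f⇔g (generic? M ⌊ f ⌋) (generic? M ⌊ g ⌋))

  -- Elimination in a unitriangular system: terms before `i` vanish by induction, and terms after
  -- `i` vanish at `f` or cancel between `f` and `g`. What remains is `c i` times 1.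
  separated⇒independent : {Φ : Matroid d → L.WQSym d} → L.Ψ ≡ Φ → (M : Vector (Matroid d) n) →
    (∀ i → Separated (M i) λ N → ∃ λ j → i Fin.< j × N ≡ M j) →
    L.LinearlyIndependent (L.WQSym-space d) (λ i → Φ (M i))
  separated⇒independent {d = d} {n} refl M separated c relation =
    λ i → vanish i (Fin.<-wellFounded i)
    where
    term : (Fin d → ℤ≥1) → Vector K.Carrier n
    term f j = c j K.* L.coeff (L.Ψ (M j)) f

    Σterm≈0 : ∀ f → sum (term f) K.≈ K.0#
    Σterm≈0 f = K.trans (K.reflexive (sym (coeff-sum (λ j → c j *ₗ L.Ψ (M j)) f))) (relation f)
      where open LeftModule (L.WQSym-space d) using (_*ₗ_)

    term≈0 : ∀ {j} f → c j K.≈ K.0# → term f j K.≈ K.0#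
    term≈0 f cj≈0 = K.trans (K.*-congʳ cj≈0) (K.zeroˡ _)

    term-¬generic : ∀ {j} f → ¬ Generic (M j) ⌊ f ⌋ → term f j K.≈ K.0#
    term-¬generic {j} f ¬g =
      K.trans (K.*-congˡ (K.reflexive (coeff-¬generic (M j) f ¬g))) (K.zeroʳ _)

    term-generic : ∀ {j} f → Generic (M j) ⌊ f ⌋ → term f j K.≈ c j
    term-generic {j} f g =
      K.trans (K.*-congˡ (K.reflexive (coeff-generic (M j) f g))) (K.*-identityʳ _)

    step : ∀ i → Separated (M i) (λ N → ∃ λ j → i Fin.< j × N ≡ M j) →
           (∀ {j} → j Fin.< i → c j K.≈ K.0#) → c i K.≈ K.0#
    step i (f , generic , inj₁ ¬later) earlier = begin
      c i        ≈⟨ term-generic f generic ⟨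
      term f i   ≈⟨ sum-cancel i (term f) (const K.0#)
                     (off-diagonal (λ j j<i → term≈0 f (earlier j<i))
                                   (λ j i<j → term-¬generic f (¬later (j , i<j , refl))))
                     (K.trans (Σterm≈0 f) (K.sym (sum-replicate-zero n))) ⟩
      K.0#       ∎
    step i (f , generic , inj₂ (g , ¬generic , later)) earlier = begin
      c i        ≈⟨ term-generic f generic ⟨
      term f i   ≈⟨ sum-cancel i (term f) (term g)
                     (off-diagonal
                       (λ j j<i → K.trans (term≈0 f (earlier j<i)) (K.sym (term≈0 g (earlier j<i))))
                       (λ j i<j → K.*-congˡ (K.reflexive (coeff-⇔ (M j) f g (later (j , i<j , refl))))))
                     (K.trans (Σterm≈0 f) (K.sym (Σterm≈0 g))) ⟩
      term g i   ≈⟨ term-¬generic g ¬generic ⟩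
      K.0#       ∎

    vanish : ∀ i → Acc Fin._<_ i → c i K.≈ K.0#
    vanish i (acc rec) = step i (separated i) λ {j} j<i → vanish j (rec j<i)

schubert-separated : ∀ {A : Subset d} → NonInitial A ⊎ A ≡ ⊤ →
                     Separated (SM A) λ N → ∃ λ B → ¬ Spans A (SM B) × N ≡ SM B
-- `⊤` spans every matroid, so the family to be separated from is empty and any function would
-- serve.
schubert-separated (inj₂ refl) = const one , ⊤-generic _ ,
  inj₁ λ (B , ¬spans , _) → contradiction (⊤-spans (SM B)) ¬spans
schubert-separated {A = A} (inj₁ (p , gap@(p∉A , _) , j , j∈A , p<j)) =
  height A p two , height-two-generic A p∉A , inj₂
    ( height A p three , height-three-¬generic A p∉A j∈A p<j
    , λ { (B , ¬spans , refl) → mk⇔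
          (height-irrelevant A two three gap ¬spans 1<2 2≤3 1<3)
          (height-irrelevant A three two gap ¬spans 1<3 ℕ.≤-refl 1<2) })
  where
  1<2 : 1 ℕ.< 2
  1<2 = s≤s (s≤s z≤n)
  1<3 : 1 ℕ.< 3
  1<3 = s≤s (s≤s z≤n)
  2≤3 : 2 ℕ.≤ 3
  2≤3 = s≤s (s≤s z≤n)

-- Enumeration and count of the representatives.

-- The order is lexicographic, with `outside` before `inside`; this makes the system triangular.
subsets : ∀ d → List (Subset d)
subsets zero    = [] ∷ []
subsets (suc d) = List.map (outside ∷_) (subsets d) ++ List.map (inside ∷_) (subsets d)

nonempties : ∀ d → List (Subset d)
nonempties zero    = []
nonempties (suc d) = List.map (outside ∷_) (nonempties d) ++ List.map (inside ∷_) (subsets d)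

-- The initial segments all have a single basis; ⊤ represents them.
representatives : ∀ d → List (Subset d)
representatives zero    = [] ∷ []
representatives (suc d) =
  List.map (outside ∷_) (nonempties d) ++ List.map (inside ∷_) (representatives d)

length-map-++ : ∀ {a} {X Y : Set a} (f g : X → Y) xs ys →
  List.length (List.map f xs ++ List.map g ys) ≡ List.length xs + List.length ys
length-map-++ f g xs ys = trans (List.length-++ (List.map f xs))
  (cong₂ _+_ (List.length-map f xs) (List.length-map g ys))

length-subsets : ∀ d → List.length (subsets d) ≡ 2 ^ d
length-subsets zero    = refl
length-subsets (suc d) = trans (length-map-++ _ _ (subsets d) (subsets d))
  (cong₂ _+_ (length-subsets d) (trans (length-subsets d) (sym (ℕ.+-identityʳ _))))

length-nonempties : ∀ d → suc (List.length (nonempties d)) ≡ 2 ^ d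
length-nonempties zero    = refl
length-nonempties (suc d) = trans (cong suc (length-map-++ _ _ (nonempties d) (subsets d)))
  (cong₂ _+_ (length-nonempties d) (trans (length-subsets d) (sym (ℕ.+-identityʳ _))))

length-representatives+d : ∀ d → List.length (representatives d) + d ≡ 2 ^ d
length-representatives+d zero    = refl
length-representatives+d (suc d) = begin
  List.length (representatives (suc d)) + suc d
      ≡⟨ cong (_+ suc d) (length-map-++ _ _ (nonempties d) (representatives d)) ⟩
  (m + r) + suc d
      -- Of the added `suc d`, one unit completes the nonempty sets to all subsets and `d` units go
      -- to the induction hypothesis.
      ≡⟨ solve 3 (λ m r d → (m :+ r) :+ (con 1 :+ d) := (con 1 :+ m) :+ (r :+ d)) refl m r d ⟩
  suc m + (r + d)        ≡⟨ cong₂ _+_ (length-nonempties d) (length-representatives+d d) ⟩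
  2 ^ d + 2 ^ d          ≡⟨ cong (2 ^ d +_) (ℕ.+-identityʳ _) ⟨
  2 ^ suc d              ∎
  where
  open ≡-Reasoning
  open +-*-Solver
  m = List.length (nonempties d)
  r = List.length (representatives d)

length-representatives : ∀ d → List.length (representatives d) ≡ 2 ^ d ∸ d
length-representatives d = trans (sym (ℕ.m+n∸n≡m _ d)) (cong (_∸ d) (length-representatives+d d))

_⋣_ : Subset d → Subset d → Set
A ⋣ B = ¬ Spans A (SM B)

-- Within each half the common first position cancels; across the halves a set without the first
-- position precedes one with it, so it cannot span.
map-++-⋣ : ∀ {xs ys : List (Subset d)} → AllPairs _⋣_ xs → AllPairs _⋣_ ys →
           AllPairs _⋣_ (List.map (outside ∷_) xs ++ List.map (inside ∷_) ys)
map-++-⋣ {xs = xs} {ys} xs! ys! = AllPairs.++⁺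
  (AllPairs.map⁺ (AllPairs.map (_∘ spans-outside) xs!))
  (AllPairs.map⁺ (AllPairs.map (_∘ spans-inside) ys!))
  (All.map⁺ (All.universal (λ _ → All.map⁺ (All.universal (λ _ → outside-¬spans-inside) ys)) xs))

subsets-⋣ : ∀ d → AllPairs _⋣_ (subsets d)
subsets-⋣ zero    = [] ∷ []
subsets-⋣ (suc d) = map-++-⋣ (subsets-⋣ d) (subsets-⋣ d)

nonempties-⋣ : ∀ d → AllPairs _⋣_ (nonempties d)
nonempties-⋣ zero    = []
nonempties-⋣ (suc d) = map-++-⋣ (nonempties-⋣ d) (subsets-⋣ d)

representatives-⋣ : ∀ d → AllPairs _⋣_ (representatives d)
representatives-⋣ zero    = [] ∷ []
representatives-⋣ (suc d) = map-++-⋣ (nonempties-⋣ d) (representatives-⋣ d)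

nonempties-nonempty : ∀ d → All Nonempty (nonempties d)
nonempties-nonempty zero    = []
nonempties-nonempty (suc d) = All.++⁺
  (All.map⁺ (All.map (λ (x , x∈) → suc x , there x∈) (nonempties-nonempty d)))
  (All.map⁺ (All.universal (λ _ → zero , here) (subsets d)))

-- The first gap is position 0, and every element comes after it.
outside-nonInitial : Nonempty A → NonInitial (outside ∷ A)
outside-nonInitial (j , j∈A) = zero , ((λ ()) , λ _ → z≤n) , suc j , there j∈A , s≤s z≤n

inside-nonInitial : NonInitial A → NonInitial (inside ∷ A)
inside-nonInitial {A = A} (p , (p∉A , p≤) , j , j∈A , p<j) =
  suc p , ((λ { (there p∈A) → p∉A p∈A }) , first) , suc j , there j∈A , s≤s p<j
  where
  first : ∀ {x} → x ∉ inside ∷ A → suc p Fin.≤ x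
  first {zero}  x∉ = contradiction here x∉
  first {suc x} x∉ = s≤s (p≤ (x∉ ∘ there))

representatives-nonInitial : ∀ d → All (λ A → NonInitial A ⊎ A ≡ ⊤) (representatives d)
representatives-nonInitial zero    = inj₂ refl ∷ []
representatives-nonInitial (suc d) = All.++⁺
  (All.map⁺ (All.map (inj₁ ∘ outside-nonInitial) (nonempties-nonempty d)))
  (All.map⁺ (All.map (Sum.map inside-nonInitial (cong (inside ∷_))) (representatives-nonInitial d)))

AllPairs-lookup : ∀ {a r} {X : Set a} {R : X → X → Set r} {xs : List X} → AllPairs R xs →
                  ∀ {i j} → i Fin.< j → R (List.lookup xs i) (List.lookup xs j)
AllPairs-lookup (x! ∷ _)  {zero}  {suc j} _         = All.lookup x! (Mem.∈-lookup j)
AllPairs-lookup (_ ∷ xs!) {suc i} {suc j} (s≤s i<j) = AllPairs-lookup xs! i<j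

representatives-separated : ∀ d → let A = List.lookup (representatives d) in
  ∀ i → Separated (SM (A i)) λ N → ∃ λ j → i Fin.< j × N ≡ SM (A j)
representatives-separated d i = separated-⊆ (SM (List.lookup (representatives d) i)) (schubert-separated
  (All.lookup (representatives-nonInitial d) (Mem.∈-lookup i)))
  λ (j , i<j , N≡) → _ , AllPairs-lookup (representatives-⋣ d) i<j , N≡

-- Specialisation to the real numbers.

Ψ-instance : Linear.Ψ ℝ-commutativeRing {d} ≡ Ψ
Ψ-instance = refl

Ψ-image : ∀ (M : Matroid d) → Image (WQSym-space d) (Ψ-linear d) (Ψ M)
Ψ-image {d} M = Free.⟨ M ⟩ , LeftModule.≈ᴹ-refl (WQSym-space d) {Ψ M}

-- Φ stands for Ψ, since conversion checking explodes if it unfolds Ψ at a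
-- Schubert matroid over ℝ.
independent-over-ℝ : {Φ : Matroid d → WQSym d} → Linear.Ψ ℝ-commutativeRing ≡ Φ →
  (M : Vector (Matroid d) n) → (∀ i → Separated (M i) λ N → ∃ λ j → i Fin.< j × N ≡ M j) →
  LinearlyIndependent (WQSym-space d) (λ i → Φ (M i))
independent-over-ℝ = separated⇒independent ℝ-commutativeRing

schubert-independent : {Φ : Matroid d → WQSym d} → Linear.Ψ ℝ-commutativeRing ≡ Φ →
  ∃ λ (A : Vector (Subset d) (2 ^ d ∸ d)) → LinearlyIndependent (WQSym-space d) (λ i → Φ (SM (A i)))
schubert-independent {d} {Φ} Ψ≡Φ = subst
  (λ n → ∃ λ (A : Vector (Subset d) n) → LinearlyIndependent (WQSym-space d) (λ i → Φ (SM (A i))))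
  (length-representatives d)
  ( List.lookup (representatives d)
  , independent-over-ℝ Ψ≡Φ (λ i → SM (List.lookup (representatives d) i)) (representatives-separated d))

-- One Schubert family witnesses both claims; `P` stands for the image of `Ψ-linear`, so that `Φ`
-- can stay opaque.
dimension-and-independent : {Φ : Matroid d → WQSym d} → Linear.Ψ ℝ-commutativeRing ≡ Φ →
  ∀ {p} (P : Pred (WQSym d) p) → (∀ M → P (Φ M)) →
  DimensionAtLeast (WQSym-space d) (2 ^ d ∸ d) P
  × ∃ λ (A : Vector (Subset d) (2 ^ d ∸ d)) → LinearlyIndependent (WQSym-space d) (λ i → Φ (SM (A i)))
dimension-and-independent {Φ = Φ} Ψ≡Φ P P-Φ = let As , independent = schubert-independent Ψ≡Φ in
  ((λ i → Φ (SM (As i))) , (λ i → P-Φ (SM (As i))) , independent) , As , independent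

theorem1p2 : (d : ℕ) →
    DimensionAtLeast (WQSym-space d) (2 ^ d ∸ d) (Image (WQSym-space d) (Ψ-linear d))
    × ∃ λ (A : Vector (Subset d) (2 ^ d ∸ d)) → LinearlyIndependent (WQSym-space d) (λ i → Ψ (SM (A i)))
theorem1p2 d = dimension-and-independent Ψ-instance
  (Image (WQSym-space d) (Ψ-linear d)) Ψ-image
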